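{- Let $k,r\geq2$ be integers and let $D$ be a constant with $D\geq 2^{r+1}rk^r(16)^k$. There exists $n_0$ such that the following holds for every real $\lambda\geq1$, with some $\alpha=\alpha(k,r,\lambda)>0$: if $G$ is a linear $r$-partite $r$-graph with $r$-partition $A_1,\dots,A_r$ such that $|A_1\cup A_2|=n\geq n_0$ and for every $v\in A_1\cup A_2$, $$Dn^{1/k}\leq|L_G(v)|\leq\lambda Dn^{1/k},$$ then $t_{C^{(r)}_{2k}}(G)\geq\alpha n^2$.
   Context: An $r$-graph is an $r$-uniform hypergraph; it is linear if any two edges share at most one vertex; it is $r$-partite with $r$-partition $A_1,\dots,A_r$ if every edge contains exactly one vertex of each $A_i$. The link of $v$ is $L_G(v)=\{I: |I|=r-1,\ I\cup\{v\}\in E(G)\}$. The linear cycle $C^{(r)}_{2k}$ is obtained from a $2$-uniform cycle of length $2k$ by enlarging each edge with its own $(r-2)$-set of new vertices, these sets being pairwise disjoint. $t_H(G)$ is the number of copies of $H$ in $G$.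
   Formalization: The constants D, λ and α are taken rational rather than real; the degree condition is stated in the equivalent form D^k n ≤ |L_G(v)|^k ≤ (λD)^k n. -}

module Defs where

open import Data.Nat as ℕ using (ℕ; zero; suc; _+_; _*_; _^_; _<ᵇ_; _≡ᵇ_)
open import Data.Bool using (Bool; true; false; _∧_; _∨_; not; if_then_else_)
open import Data.Fin as Fin using (Fin; toℕ)
open import Data.List as List using (List; []; _∷_; length; filter; allFin; concatMap; map)
open import Data.Product using (_×_)
open import Relation.Nullary using (¬_)
open import Data.List.Relation.Unary.Unique.Propositional using (Unique)
open import Data.List.Membership.Propositional as LMem using ()
open import Data.Vec as Vec using (Vec; []; _∷_)
open import Data.Vec.Membership.Propositional as VMem using ()
import Data.Vec.Membership.DecPropositional as VDec
open import Data.Integer using (+_)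
open import Data.Rational as ℚ using (ℚ)
open import Relation.Nullary.Decidable using (⌊_⌋)
open import Relation.Binary.PropositionalEquality using (_≡_)

ℕtoℚ : ℕ → ℚ
ℕtoℚ n = (+ n) ℚ./ 1

_^ℚ_ : ℚ → ℕ → ℚ
q ^ℚ zero  = ℚ.1ℚ
q ^ℚ suc m = q ℚ.* (q ^ℚ m)

countB : ∀ {a} {A : Set a} → (A → Bool) → List A → ℕ
countB p []       = 0
countB p (x ∷ xs) = if p x then suc (countB p xs) else countB p xs

allVec : (p m : ℕ) → List (Vec (Fin p) m)
allVec p zero    = [] ∷ []
allVec p (suc m) = concatMap (λ i → map (i ∷_) (allVec p m)) (allFin p)

allB : ∀ {a} {A : Set a} → (A → Bool) → List A → Bool
allB p []       = true
allB p (x ∷ xs) = p x ∧ allB p xs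

-- r-partite r-graphs
--
-- Vertex set: Fin N.  part v = index of the class A_{part v + 1}
-- containing v (classes indexed 0,…,r-1; A_1 ↔ 0, A_2 ↔ 1).
-- An edge is stored as a vector e : Vec (Fin N) r whose i-th entry is
-- its unique vertex in the i-th class (so the vector is a canonical
-- representation of the r-set of its entries).

record RPartiteGraph (r : ℕ) : Set where
  field
    N     : ℕ
    part  : Fin N → ℕ
    edges : List (Vec (Fin N) r)

module _ {r : ℕ} (G : RPartiteGraph r) where
  open RPartiteGraph G
  open VDec (Fin._≟_ {N}) using (_∈?_)

  IsRPartite : Set
  IsRPartite =
    (∀ v → part v ℕ.< r)
    × ((∀ e → e LMem.∈ edges → ∀ (i : Fin r) → part (Vec.lookup e i) ≡ toℕ i)
    × Unique edges)

  IsLinear : Set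
  IsLinear = ∀ e f → e LMem.∈ edges → f LMem.∈ edges → ¬ (e ≡ f) →
             ∀ u w → u VMem.∈ e → u VMem.∈ f → w VMem.∈ e → w VMem.∈ f → u ≡ w

  sizeA12 : ℕ
  sizeA12 = countB (λ v → part v <ᵇ 2) (allFin N)

  -- |L_G(v)|: the link sets I correspond bijectively to the edges
  -- I ∪ {v} containing v, so |L_G(v)| is the number of edges containing v.
  linkSize : Fin N → ℕ
  linkSize v = countB (λ e → ⌊ v ∈? e ⌋) edges

  -- |e ∩ f| for edges (entries of an edge are distinct)
  interSize : Vec (Fin N) r → Vec (Fin N) r → ℕ
  interSize e f = countB (λ u → ⌊ u ∈? f ⌋) (Vec.toList e)

  adjacent : (m : ℕ) → Fin m → Fin m → Bool
  adjacent m i j =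
       (suc (toℕ i) ≡ᵇ toℕ j) ∨ (suc (toℕ j) ≡ᵇ toℕ i)
    ∨ ((suc (toℕ i) ≡ᵇ m) ∧ (toℕ j ≡ᵇ 0))
    ∨ ((suc (toℕ j) ≡ᵇ m) ∧ (toℕ i ≡ᵇ 0))

  isLinearCycle : (m : ℕ) → (Fin m → Vec (Fin N) r) → Bool
  isLinearCycle m f =
    allB (λ i → allB (λ j →
      if adjacent m i j then interSize (f i) (f j) ≡ᵇ 1
      else ((toℕ i ≡ᵇ toℕ j) ∨ (interSize (f i) (f j) ≡ᵇ 0)))
      (allFin m)) (allFin m)

  -- Canonical representative of a copy: a copy of C_m (m ≥ 3) is an edge
  -- set whose cyclic orderings form one orbit of the dihedral group of
  -- size 2m; exactly one of them has its first entry the smallest (in the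
  -- edge list) and its second entry smaller than its last.
  isCanonical : (m : ℕ) → Vec (Fin (length edges)) m → Bool
  isCanonical zero s = true
  isCanonical (suc m) s =
    allB (λ i → toℕ (Vec.lookup s Fin.zero) ℕ.≤ᵇ toℕ (Vec.lookup s i)) (allFin (suc m))
    ∧ secondLessLast m s
    where
    secondLessLast : (m : ℕ) → Vec (Fin (length edges)) (suc m) → Bool
    secondLessLast zero    s = true
    secondLessLast (suc m) (_ ∷ s) = toℕ (Vec.head s) <ᵇ toℕ (Vec.last s)

  tCycle : (k : ℕ) → ℕ
  tCycle k = countB
    (λ s → isLinearCycle (2 * k) (λ i → List.lookup edges (Vec.lookup s i))
           ∧ isCanonical (2 * k) s)
    (allVec (length edges) (2 * k))

{-# OPTIONS --safe #-}
module Submission where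

-- Every edge joins its vertex in A₁ to its vertex in A₂, and by linearity this gives a simple
-- graph on the n vertices of A₁ ∪ A₂.  Weight a closed walk of length 2j by the product of
-- 1/deg over its vertices and let H j be the total weight.  Reversibility of the random walk and
-- Cauchy–Schwarz give H j ≥ 1 and log-convexity of H, so H (k-1) ^ k ≤ n * H k ^ (k-1).
-- A closed walk that is not a linear cycle has, after a rotation, a first edge conflicting with
-- one of the next k edges; given the rest of the long arc, linearity leaves at most r + 1 choices
-- per later edge for it.  Balancing the weights of the two arcs (Janzer's argument for rainbow
-- even cycles) bounds the weight of such walks by a small multiple of H k + n^(-1/k) * H (k-1),
-- hence by H k / 2.  What remains consists of linear cycles, each of weight at most 1/n², so there
-- are of order n² of them; weighting by 1/deg makes the constant independent of λ.
-- All weights are scaled by a common multiple Q of the degrees, to stay in ℕ.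

open import Data.List as List using (List; []; _∷_; _++_; _∷ʳ_; _∷ʳ′_; map; concatMap; length; reverse; initLast; allFin; take; filter; upTo; cartesianProduct)
open import Data.List.Membership.Propositional using (_∈_; find; lose)
open import Data.List.Membership.Propositional.Properties using (∈-map⁻; ∈-concatMap⁻; ∈-lookup; ∈-allFin; ∈-filter⁺; ∈-filter⁻; ∈-upTo⁺)
open import Data.List.Properties using (++-assoc; ++-identityʳ; length-++; length-map; length-upTo; length-tabulate; length-reverse; reverse-++; reverse-involutive; unfold-reverse; map-++; map-tabulate; ∷-injective; ∷ʳ-injectiveʳ)
open import Data.List.Relation.Unary.All as All using (All; []; _∷_)
open import Data.List.Relation.Unary.AllPairs using (_∷_; [])
open import Data.List.Relation.Unary.Any using (here; there; any?; satisfied)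
open import Data.List.Relation.Unary.Unique.Propositional using (Unique)
open import Data.Nat renaming (_≟_ to _≟ℕ_)
open import Data.Nat.Properties hiding (_≟_)
open import Data.Nat.Tactic.RingSolver using (solve-∀)
open import Data.Product using (Σ; ∃; _×_; _,_; proj₁; proj₂)
open import Data.Sum using (_⊎_; inj₁; inj₂)
open import Function using (_∘_; id)
open import Relation.Binary.Definitions using (DecidableEquality; tri<; tri≈; tri>)
open import Relation.Binary.PropositionalEquality
open import Relation.Nullary using (Dec; yes; no; does; contradiction; ¬_; ¬?; _×-dec_; _⊎-dec_)
open import Relation.Nullary.Decidable using (⌊_⌋; map′; decidable-stable)

-- In normalised terms (`Q = 1`) a closed walk of length 2k is cut into its first edge, a long arc
-- of k edges and a short arc of k - 1 edges. The obstacle: linearity limits the choices of a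
-- conflicting first edge once the long arc is known, but the weight of the short arc depends on
-- that very edge, so the saving cannot be taken directly. Trading the short arc for a second long
-- one gives a multiple of `H k` that a free parameter makes small. Trading the long arc for a
-- second short one gives `H (k-1)` and gains one factor 1/deg, at most n^(-1/k) divided by a large
-- constant. The second term is harmless because `H (k-1) ≤ n^(1/k) * H k`, which follows from
-- log-convexity with `H 0 = n` together with `H k ≥ 1`. Arcs of these lengths also suffice to
-- detect every conflict: of two edges of a closed walk of length 2k, one is always among the k
-- edges that follow the other. Backtracking and repeated vertices force conflicts too, so
-- degenerate closed walks need no separate treatment.

-- Finite sums over lists.

∑ : ∀ {a} {A : Set a} → List A → (A → ℕ) → ℕ
∑ []       f = 0
∑ (x ∷ xs) f = f x + ∑ xs f

𝟙 : ∀ {ℓ} {P : Set ℓ} → Dec P → ℕ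
𝟙 (yes _) = 1
𝟙 (no _)  = 0

𝟙≤1 : ∀ {ℓ} {P : Set ℓ} (P? : Dec P) → 𝟙 P? ≤ 1
𝟙≤1 (yes _) = ≤-refl
𝟙≤1 (no _)  = z≤n

𝟙-yes : ∀ {ℓ} {P : Set ℓ} (P? : Dec P) → P → 𝟙 P? ≡ 1
𝟙-yes (yes _) _ = refl
𝟙-yes (no ¬p) p = contradiction p ¬p

+-interchange : ∀ a b c d → (a + b) + (c + d) ≡ (a + c) + (b + d)
+-interchange = solve-∀

module _ {a} {A : Set a} where

  ∑-mono-∈ : ∀ (xs : List A) {f g} → (∀ {x} → x ∈ xs → f x ≤ g x) → ∑ xs f ≤ ∑ xs g
  ∑-mono-∈ []       h = z≤n
  ∑-mono-∈ (x ∷ xs) h = +-mono-≤ (h (here refl)) (∑-mono-∈ xs (h ∘ there))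

  ∑-mono : ∀ (xs : List A) {f g} → (∀ x → f x ≤ g x) → ∑ xs f ≤ ∑ xs g
  ∑-mono xs h = ∑-mono-∈ xs (λ {x} _ → h x)

  ∑-cong-∈ : ∀ (xs : List A) {f g} → (∀ {x} → x ∈ xs → f x ≡ g x) → ∑ xs f ≡ ∑ xs g
  ∑-cong-∈ []       h = refl
  ∑-cong-∈ (x ∷ xs) h = cong₂ _+_ (h (here refl)) (∑-cong-∈ xs (h ∘ there))

  ∑-cong : ∀ (xs : List A) {f g} → (∀ x → f x ≡ g x) → ∑ xs f ≡ ∑ xs g
  ∑-cong xs h = ∑-cong-∈ xs (λ {x} _ → h x)

  ∑-+ : ∀ (xs : List A) f g → ∑ xs (λ x → f x + g x) ≡ ∑ xs f + ∑ xs g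
  ∑-+ []       f g = refl
  ∑-+ (x ∷ xs) f g = trans (cong (f x + g x +_) (∑-+ xs f g))
                           (+-interchange (f x) (g x) (∑ xs f) (∑ xs g))

  ∑-*ˡ : ∀ (xs : List A) c f → ∑ xs (λ x → c * f x) ≡ c * ∑ xs f
  ∑-*ˡ []       c f = sym (*-zeroʳ c)
  ∑-*ˡ (x ∷ xs) c f = trans (cong (c * f x +_) (∑-*ˡ xs c f))
                            (sym (*-distribˡ-+ c (f x) (∑ xs f)))

  ∑-*ʳ : ∀ (xs : List A) c f → ∑ xs (λ x → f x * c) ≡ ∑ xs f * c
  ∑-*ʳ []       c f = refl
  ∑-*ʳ (x ∷ xs) c f = trans (cong (f x * c +_) (∑-*ʳ xs c f))
                            (sym (*-distribʳ-+ c (f x) (∑ xs f)))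

  ∑-0 : ∀ (xs : List A) → ∑ xs (λ _ → 0) ≡ 0
  ∑-0 []       = refl
  ∑-0 (x ∷ xs) = ∑-0 xs

  ∑-const : ∀ (xs : List A) c → ∑ xs (λ _ → c) ≡ length xs * c
  ∑-const []       c = refl
  ∑-const (x ∷ xs) c = cong (c +_) (∑-const xs c)

  ∑-++ : ∀ (xs ys : List A) f → ∑ (xs ++ ys) f ≡ ∑ xs f + ∑ ys f
  ∑-++ []       ys f = refl
  ∑-++ (x ∷ xs) ys f = trans (cong (f x +_) (∑-++ xs ys f)) (sym (+-assoc (f x) _ _))

  term≤∑ : ∀ {xs : List A} f {x} → x ∈ xs → f x ≤ ∑ xs f
  term≤∑ f (here refl) = m≤m+n _ _
  term≤∑ f (there x∈)  = ≤-trans (term≤∑ f x∈) (m≤n+m _ _)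

  ∑-at-most-one : ∀ {ℓ} {P : A → Set ℓ} (P? : ∀ x → Dec (P x)) {xs : List A} → Unique xs →
                  (∀ {x y} → P x → P y → x ≡ y) → ∑ xs (𝟙 ∘ P?) ≤ 1
  ∑-at-most-one P? {[]}     _          _ = z≤n
  ∑-at-most-one P? {x ∷ xs} (x∉ ∷ xs!) h with P? x
  ... | no  _  = ∑-at-most-one P? xs! h
  ... | yes px = s≤s (≤-reflexive (trans (∑-cong-∈ xs absent) (∑-0 xs)))
    where
    absent : ∀ {y} → y ∈ xs → 𝟙 (P? y) ≡ 0
    absent {y} y∈ with P? y
    ... | yes py = contradiction (h px py) (All.lookup x∉ y∈)
    ... | no  _  = refl

  ∑-δ : (_≟′_ : DecidableEquality A) → ∀ {xs : List A} → Unique xs → ∀ {x} → x ∈ xs →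
        ∀ (f : A → ℕ) → ∑ xs (λ y → 𝟙 (x ≟′ y) * f y) ≡ f x
  ∑-δ _≟′_ {z ∷ xs} (z∉ ∷ xs!) {x} (here refl) f with x ≟′ x
  ... | no x≢x = contradiction refl x≢x
  ... | yes _  = trans (cong₂ _+_ (*-identityˡ (f x)) (trans (∑-cong-∈ xs absent) (∑-0 xs)))
                       (+-identityʳ (f x))
    where
    absent : ∀ {y} → y ∈ xs → 𝟙 (x ≟′ y) * f y ≡ 0
    absent {y} y∈ with x ≟′ y
    ... | yes x≡y = contradiction x≡y (All.lookup z∉ y∈)
    ... | no  _   = refl
  ∑-δ _≟′_ {z ∷ xs} (z∉ ∷ xs!) {x} (there x∈) f with x ≟′ z
  ... | yes refl = contradiction refl (All.lookup z∉ x∈)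
  ... | no  _    = ∑-δ _≟′_ xs! x∈ f

module _ {a b} {A : Set a} {B : Set b} where

  ∑-swap : ∀ (xs : List A) (ys : List B) (f : A → B → ℕ) →
           ∑ xs (λ x → ∑ ys (f x)) ≡ ∑ ys (λ y → ∑ xs (λ x → f x y))
  ∑-swap []       ys f = sym (∑-0 ys)
  ∑-swap (x ∷ xs) ys f = trans (cong (∑ ys (f x) +_) (∑-swap xs ys f))
                               (sym (∑-+ ys (f x) (λ y → ∑ xs (λ x′ → f x′ y))))

  ∑-map : ∀ (g : A → B) (xs : List A) f → ∑ (map g xs) f ≡ ∑ xs (f ∘ g)
  ∑-map g []       f = refl
  ∑-map g (x ∷ xs) f = cong (f (g x) +_) (∑-map g xs f)

  ∑-concatMap : ∀ (g : A → List B) (xs : List A) f →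
                ∑ (concatMap g xs) f ≡ ∑ xs (λ x → ∑ (g x) f)
  ∑-concatMap g []       f = refl
  ∑-concatMap g (x ∷ xs) f = trans (∑-++ (g x) (concatMap g xs) f)
                                   (cong (∑ (g x) f +_) (∑-concatMap g xs f))

-- Powers, the AM-GM inequality and Cauchy-Schwarz in ℕ.

m²≤n²⇒m≤n : ∀ m n → m * m ≤ n * n → m ≤ n
m²≤n²⇒m≤n m n h with m ≤? n
... | yes m≤n = m≤n
... | no  m≰n = contradiction h (<⇒≱ (*-mono-< (≰⇒> m≰n) (≰⇒> m≰n)))

^-cancelˡ-≤ : ∀ k .{{_ : NonZero k}} m n → m ^ k ≤ n ^ k → m ≤ n
^-cancelˡ-≤ k m n h with m ≤? n
... | yes m≤n = m≤n
... | no  m≰n = contradiction h (<⇒≱ (^-monoˡ-< k (≰⇒> m≰n)))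

^-distribʳ-* : ∀ m n k → (m * n) ^ k ≡ m ^ k * n ^ k
^-distribʳ-* m n zero    = refl
^-distribʳ-* m n (suc k) = trans (cong (m * n *_) (^-distribʳ-* m n k)) (swap m n (m ^ k) (n ^ k))
  where
  swap : ∀ a b c d → a * b * (c * d) ≡ a * c * (b * d)
  swap = solve-∀

-- The geometric mean enters as any `z` whose square is at most `s * t`, which avoids square roots
-- in ℕ.
am-gm : ∀ s t z → z * z ≤ s * t → 2 * z ≤ s + t
am-gm s t z h = m²≤n²⇒m≤n (2 * z) (s + t) (begin
  2 * z * (2 * z)   ≡⟨ e₁ z ⟩
  4 * (z * z)       ≤⟨ *-monoʳ-≤ 4 h ⟩
  4 * (s * t)       ≤⟨ four s t ⟩
  (s + t) * (s + t) ∎)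
  where
  open ≤-Reasoning
  e₁ : ∀ z → 2 * z * (2 * z) ≡ 4 * (z * z)
  e₁ = solve-∀
  e₂ : ∀ s d → 4 * (s * (s + d)) + d * d ≡ (s + (s + d)) * (s + (s + d))
  e₂ = solve-∀
  ordered : ∀ {s t} → s ≤ t → 4 * (s * t) ≤ (s + t) * (s + t)
  ordered {s} s≤t with m≤n⇒∃[o]m+o≡n s≤t
  ... | (d , refl) = ≤-trans (m≤m+n _ (d * d)) (≤-reflexive (e₂ s d))
  four : ∀ s t → 4 * (s * t) ≤ (s + t) * (s + t)
  four s t with ≤-total s t
  ... | inj₁ s≤t = ordered s≤t
  ... | inj₂ t≤s = subst₂ (λ u v → 4 * u ≤ v * v) (*-comm t s) (+-comm t s) (ordered t≤s)

-- Induction on the list, with AM-GM for the cross term. Since hypothesis and conclusion have the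
-- same shape, the lemma nests: the inequality for an inner sum is the hypothesis for the outer one,
-- which is how double sums are treated.
cauchy-schwarz : ∀ {a} {A : Set a} (xs : List A) (f g h : A → ℕ) →
                 (∀ {x} → x ∈ xs → h x * h x ≤ f x * g x) →
                 ∑ xs h * ∑ xs h ≤ ∑ xs f * ∑ xs g
cauchy-schwarz []       f g h hyp = z≤n
cauchy-schwarz (x ∷ xs) f g h hyp = begin
  (c + C) * (c + C)                 ≡⟨ e₁ c C ⟩
  c * c + (2 * (c * C) + C * C)     ≤⟨ +-mono-≤ c²≤ab (+-mono-≤ (am-gm (a * B) (A * b) (c * C) cross) C²≤AB) ⟩
  a * b + (a * B + A * b + A * B)   ≡⟨ e₂ a b A B ⟩
  (a + A) * (b + B)                 ∎
  where
  open ≤-Reasoning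
  a = f x
  b = g x
  c = h x
  A = ∑ xs f
  B = ∑ xs g
  C = ∑ xs h
  c²≤ab : c * c ≤ a * b
  c²≤ab = hyp (here refl)
  C²≤AB : C * C ≤ A * B
  C²≤AB = cauchy-schwarz xs f g h (hyp ∘ there)
  e₀ : ∀ a b c d → (a * b) * (c * d) ≡ (a * d) * (c * b)
  e₀ = solve-∀
  e₁ : ∀ c C → (c + C) * (c + C) ≡ c * c + (2 * (c * C) + C * C)
  e₁ = solve-∀
  e₂ : ∀ a b A B → a * b + (a * B + A * b + A * B) ≡ (a + A) * (b + B)
  e₂ = solve-∀
  e₃ : ∀ c C → (c * C) * (c * C) ≡ (c * c) * (C * C)
  e₃ = solve-∀
  cross : (c * C) * (c * C) ≤ (a * B) * (A * b)
  cross = begin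
    (c * C) * (c * C) ≡⟨ e₃ c C ⟩
    (c * c) * (C * C) ≤⟨ *-mono-≤ c²≤ab C²≤AB ⟩
    (a * b) * (A * B) ≡⟨ e₀ a b A B ⟩
    (a * B) * (A * b) ∎

-- Sums over words, and their invariance under rotation and reversal.

module _ {a} {A : Set a} (xs : List A) where

  words : ℕ → List (List A)
  words zero    = [] ∷ []
  words (suc l) = concatMap (λ x → map (x ∷_) (words l)) xs

  ∑-words-suc : ∀ l F → ∑ (words (suc l)) F ≡ ∑ xs (λ x → ∑ (words l) (λ v → F (x ∷ v)))
  ∑-words-suc l F = trans (∑-concatMap _ xs F) (∑-cong xs (λ x → ∑-map (x ∷_) (words l) F))

  length-words : ∀ l {v} → v ∈ words l → length v ≡ l
  length-words zero    (here refl) = refl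
  length-words (suc l) v∈ with satisfied (∈-concatMap⁻ (λ x → map (x ∷_) (words l)) {xs = xs} v∈)
  ... | x , v∈′ with ∈-map⁻ (x ∷_) v∈′
  ... | w , w∈ , refl = cong suc (length-words l w∈)

  ∑-words-+ : ∀ k l F →
    ∑ (words (k + l)) F ≡ ∑ (words k) (λ u → ∑ (words l) (λ v → F (u ++ v)))
  ∑-words-+ zero    l F = sym (+-identityʳ _)
  ∑-words-+ (suc k) l F = trans (∑-words-suc (k + l) F)
    (trans (∑-cong xs (λ x → ∑-words-+ k l (λ v → F (x ∷ v))))
           (sym (∑-words-suc k (λ u → ∑ (words l) (λ v → F (u ++ v))))))

  ∑-words-snoc : ∀ l F →
    ∑ xs (λ x → ∑ (words l) (λ v → F (v ++ x ∷ []))) ≡ ∑ (words (suc l)) F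
  ∑-words-snoc zero    F = sym (∑-words-suc 0 F)
  ∑-words-snoc (suc l) F =
    trans (∑-cong xs (λ x → ∑-words-suc l (λ v → F (v ++ x ∷ []))))
    (trans (∑-swap xs xs _)
    (trans (∑-cong xs (λ y → ∑-words-snoc l (λ v → F (y ∷ v))))
           (sym (∑-words-suc (suc l) F))))

module _ {a} {A : Set a} where

  rotate : List A → List A
  rotate []       = []
  rotate (x ∷ xs) = xs ++ x ∷ []

  rotates : ℕ → List A → List A
  rotates zero    s = s
  rotates (suc i) s = rotates i (rotate s)

  rotates-++ : ∀ (u v : List A) → rotates (length u) (u ++ v) ≡ v ++ u
  rotates-++ []      v = sym (++-identityʳ v)
  rotates-++ (x ∷ u) v = trans (cong (rotates (length u)) (++-assoc u v (x ∷ [])))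
    (trans (rotates-++ u (v ++ x ∷ [])) (++-assoc v (x ∷ []) u))

  take-length-++ : ∀ (u v : List A) → take (length u) (u ++ v) ≡ u
  take-length-++ []      v = refl
  take-length-++ (x ∷ u) v = cong (x ∷_) (take-length-++ u v)

  ∑-words-rotate : ∀ xs l (F : List A → ℕ) → ∑ (words xs l) (F ∘ rotate) ≡ ∑ (words xs l) F
  ∑-words-rotate xs zero    F = refl
  ∑-words-rotate xs (suc l) F = trans (∑-words-suc xs l (F ∘ rotate)) (∑-words-snoc xs l F)

  ∑-words-rotates : ∀ xs l i (F : List A → ℕ) → ∑ (words xs l) (F ∘ rotates i) ≡ ∑ (words xs l) F
  ∑-words-rotates xs l zero    F = refl
  ∑-words-rotates xs l (suc i) F =
    trans (∑-words-rotate xs l (F ∘ rotates i)) (∑-words-rotates xs l i F)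

  ∑-words-reverse : ∀ xs l (F : List A → ℕ) → ∑ (words xs l) (F ∘ reverse) ≡ ∑ (words xs l) F
  ∑-words-reverse xs zero    F = refl
  ∑-words-reverse xs (suc l) F = begin
    ∑ (words xs (suc l)) (F ∘ reverse)
      ≡⟨ ∑-words-suc xs l (F ∘ reverse) ⟩
    ∑ xs (λ x → ∑ (words xs l) (λ v → F (reverse (x ∷ v))))
      ≡⟨ ∑-cong xs (λ x → ∑-cong (words xs l) (λ v → cong F (unfold-reverse x v))) ⟩
    ∑ xs (λ x → ∑ (words xs l) (λ v → F (reverse v ++ x ∷ [])))
      ≡⟨ ∑-cong xs (λ x → ∑-words-reverse xs l (λ v → F (v ++ x ∷ []))) ⟩
    ∑ xs (λ x → ∑ (words xs l) (λ v → F (v ++ x ∷ [])))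
      ≡⟨ ∑-words-snoc xs l F ⟩
    ∑ (words xs (suc l)) F ∎
    where open ≡-Reasoning

-- Weighted walks on a graph

-- The parameter `c` is chosen so that `2k * B` costs at most half of `T`: its first part is
-- `2k * kσ / c = 1/4` of `T`, and its second part `2k * c * R` is at most `T / 4` by the last
-- hypothesis.
absorb-bad : ∀ k σ T X B R c → c ≡ 8 * (σ * (k * k)) → 0 < c →
  T ≤ X + (k + k) * B → c * B ≤ k * σ * T + c * c * R → 8 * k * c * R ≤ T → T ≤ 2 * X
absorb-bad k σ T X B R c c≡ c>0 T≤ cB≤ R≤ =
  *-cancelˡ-≤ (2 * c) {{m*n≢0 2 c {{_}} {{>-nonZero c>0}}}} (+-cancelˡ-≤ (2 * (c * T)) _ _ (begin
    2 * (c * T) + 2 * c * T                                           ≡⟨ e₁ c T ⟩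
    4 * c * T                                                         ≤⟨ *-monoʳ-≤ (4 * c) T≤ ⟩
    4 * c * (X + (k + k) * B)                                         ≡⟨ e₂ c X k B ⟩
    4 * (c * X) + 8 * k * (c * B)                                     ≤⟨ +-monoʳ-≤ (4 * (c * X)) (*-monoʳ-≤ (8 * k) cB≤) ⟩
    4 * (c * X) + 8 * k * (k * σ * T + c * c * R)                     ≡⟨ e₃ c X k σ T R ⟩
    8 * (σ * (k * k)) * T + c * (8 * k * c * R) + 2 * c * (2 * X)     ≤⟨ +-monoˡ-≤ (2 * c * (2 * X)) (+-mono-≤ (≤-reflexive (cong (_* T) (sym c≡))) (*-monoʳ-≤ c R≤)) ⟩
    c * T + c * T + 2 * c * (2 * X)                                   ≡⟨ cong (_+ 2 * c * (2 * X)) (e₄ (c * T)) ⟩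
    2 * (c * T) + 2 * c * (2 * X)                                     ∎))
  where
  open ≤-Reasoning
  e₁ : ∀ c T → 2 * (c * T) + 2 * c * T ≡ 4 * c * T
  e₁ = solve-∀
  e₂ : ∀ c X k B → 4 * c * (X + (k + k) * B) ≡ 4 * (c * X) + 8 * k * (c * B)
  e₂ = solve-∀
  e₃ : ∀ c X k σ T R → 4 * (c * X) + 8 * k * (k * σ * T + c * c * R) ≡
                       8 * (σ * (k * k)) * T + c * (8 * k * c * R) + 2 * c * (2 * X)
  e₃ = solve-∀
  e₄ : ∀ a → a + a ≡ 2 * a
  e₄ = solve-∀

-- A union bound made for rotations: they all have the same weight, so a single nonzero `b i`
-- already pays for the whole of `w`.
covered-≤ : ∀ m (b f : ℕ → ℕ) w x → (∀ i → f i ≡ w) →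
  (¬ w ≡ 0 → (∀ i → i < m → b i ≡ 0) → w ≤ x) → w ≤ x + ∑ (upTo m) (λ i → b i * f i)
covered-≤ m b f w x f≡w h with w ≟ℕ 0 | any? (λ i → ¬? (b i ≟ℕ 0)) (upTo m)
... | yes w≡0 | _ = ≤-trans (≤-reflexive w≡0) z≤n
... | no w≢0 | no none = ≤-trans (h w≢0 (λ i i<m → decidable-stable (b i ≟ℕ 0) (none ∘ lose (∈-upTo⁺ i<m)))) (m≤m+n x _)
... | no w≢0 | yes some with find some
... | i , i∈ , bi≢0 = begin
  w                                     ≡⟨ f≡w i ⟨
  f i                                   ≤⟨ m≤n*m (f i) (b i) {{≢-nonZero bi≢0}} ⟩
  b i * f i                             ≤⟨ term≤∑ (λ i → b i * f i) i∈ ⟩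
  ∑ (upTo m) (λ i → b i * f i)          ≤⟨ m≤n+m _ x ⟩
  x + ∑ (upTo m) (λ i → b i * f i)      ∎
  where open ≤-Reasoning

-- Darts are oriented edges and `inv` reverses them. Bijectivity of `inv` is expressed by `∑-inv`,
-- the form in which sums use it.
record Network : Set₁ where
  field
    V D      : Set
    _≟_      : DecidableEquality V
    Vs       : List V
    Ds       : List D
    tail     : D → V
    head     : D → V
    inv      : D → D
    Vs!      : Unique Vs
    tail∈    : ∀ d → tail d ∈ Vs
    head∈    : ∀ d → head d ∈ Vs
    tail-inv : ∀ d → tail (inv d) ≡ head d
    head-inv : ∀ d → head (inv d) ≡ tail d
    ∑-inv    : ∀ f → ∑ Ds (f ∘ inv) ≡ ∑ Ds f

  δ : V → V → ℕ
  δ x y = 𝟙 (x ≟ y)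

  deg : V → ℕ
  deg x = ∑ Ds (λ d → δ x (tail d))

  field
    p     : V → ℕ
    Q     : ℕ
    Q>0   : 0 < Q
    p*deg : ∀ {x} → x ∈ Vs → p x * deg x ≡ Q

-- The normalisation p x * deg x ≡ Q makes p x / Q the transition probability out of x,
-- so W l x y / Q ^ l is, up to reversal, the l-step kernel of the simple random walk.

module Walks (Net : Network) where
  open Network Net

  δ-sym : ∀ x y → δ x y ≡ δ y x
  δ-sym x y with x ≟ y | y ≟ x
  ... | yes _   | yes _   = refl
  ... | no  _   | no  _   = refl
  ... | yes x≡y | no  y≢x = contradiction (sym x≡y) y≢x
  ... | no  x≢y | yes y≡x = contradiction (sym y≡x) x≢y

  δ-subst : ∀ x y (f : V → ℕ) → δ x y * f x ≡ δ x y * f y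
  δ-subst x y f with x ≟ y
  ... | yes refl = refl
  ... | no  _    = refl

  ∑δ : ∀ {x} → x ∈ Vs → (f : V → ℕ) → ∑ Vs (λ y → δ x y * f y) ≡ f x
  ∑δ = ∑-δ _≟_ Vs!

  ∑δ-right : ∀ {x} → x ∈ Vs → ∑ Vs (λ y → δ y x) ≡ 1
  ∑δ-right {x} x∈ = trans (∑-cong Vs (λ y → trans (δ-sym y x) (sym (*-identityʳ (δ x y)))))
                          (∑δ x∈ (λ _ → 1))

  ∑-tail : ∀ (f : V → ℕ) → ∑ Ds (λ d → f (tail d)) ≡ ∑ Vs (λ x → deg x * f x)
  ∑-tail f = begin
    ∑ Ds (λ d → f (tail d))                        ≡⟨ ∑-cong Ds (λ d → ∑δ (tail∈ d) f) ⟨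
    ∑ Ds (λ d → ∑ Vs (λ x → δ (tail d) x * f x))   ≡⟨ ∑-swap Ds Vs _ ⟩
    ∑ Vs (λ x → ∑ Ds (λ d → δ (tail d) x * f x))   ≡⟨ ∑-cong Vs (λ x → ∑-*ʳ Ds (f x) _) ⟩
    ∑ Vs (λ x → ∑ Ds (λ d → δ (tail d) x) * f x)   ≡⟨ ∑-cong Vs (λ x → cong (_* f x) (∑-cong Ds (λ d → δ-sym (tail d) x))) ⟩
    ∑ Vs (λ x → deg x * f x)                       ∎
    where open ≡-Reasoning

  ∑-head : ∀ (f : V → ℕ) → ∑ Ds (λ d → f (head d)) ≡ ∑ Vs (λ x → deg x * f x)
  ∑-head f = trans (∑-cong Ds (λ d → cong f (sym (tail-inv d))))
                   (trans (∑-inv (f ∘ tail)) (∑-tail f))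

  ∑-deg-p : ∀ (f : V → ℕ) → ∑ Vs (λ x → deg x * (p x * f x)) ≡ Q * ∑ Vs f
  ∑-deg-p f = trans (∑-cong-∈ Vs (λ {x} x∈ → trans (e (deg x) (p x) (f x)) (cong (_* f x) (p*deg x∈))))
                    (∑-*ˡ Vs Q f)
    where
    e : ∀ a b c → a * (b * c) ≡ b * a * c
    e = solve-∀

  W : ℕ → V → V → ℕ
  W zero    x y = δ x y
  W (suc l) x y = ∑ Ds (λ d → δ x (tail d) * (p (head d) * W l (head d) y))

  factor-out : ∀ {B : Set} (ys : List B) (a b : D → ℕ) (c : D → B → ℕ) (r : B → ℕ) →
    ∑ Ds (λ d → a d * (b d * ∑ ys (λ y → c d y * r y))) ≡
    ∑ ys (λ y → ∑ Ds (λ d → a d * (b d * c d y)) * r y)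
  factor-out ys a b c r = begin
    ∑ Ds (λ d → a d * (b d * ∑ ys (λ y → c d y * r y)))
      ≡⟨ ∑-cong Ds (λ d → sym (trans (∑-*ˡ ys (a d) _) (cong (a d *_) (∑-*ˡ ys (b d) _)))) ⟩
    ∑ Ds (λ d → ∑ ys (λ y → a d * (b d * (c d y * r y))))
      ≡⟨ ∑-swap Ds ys _ ⟩
    ∑ ys (λ y → ∑ Ds (λ d → a d * (b d * (c d y * r y))))
      ≡⟨ ∑-cong ys (λ y → trans (∑-cong Ds (λ d → e (a d) (b d) (c d y) (r y))) (∑-*ʳ Ds (r y) _)) ⟩
    ∑ ys (λ y → ∑ Ds (λ d → a d * (b d * c d y)) * r y) ∎
    where
    open ≡-Reasoning
    e : ∀ a b c r → a * (b * (c * r)) ≡ a * (b * c) * r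
    e = solve-∀

  W-+ : ∀ i j {x} z → x ∈ Vs → W (i + j) x z ≡ ∑ Vs (λ y → W i x y * W j y z)
  W-+ zero    j     z x∈ = sym (∑δ x∈ (λ y → W j y z))
  W-+ (suc i) j {x} z x∈ = trans
    (∑-cong Ds (λ d → cong (λ t → δ x (tail d) * (p (head d) * t)) (W-+ i j z (head∈ d))))
    (factor-out Vs (λ d → δ x (tail d)) (p ∘ head) (λ d y → W i (head d) y) (λ y → W j y z))

  W-suc-right : ∀ l y x →
    W (suc l) y x ≡ ∑ Ds (λ d → W l y (tail d) * (p (head d) * δ (head d) x))
  W-suc-right zero    y x = refl
  W-suc-right (suc l) y x = trans
    (∑-cong Ds (λ d → cong (λ t → δ y (tail d) * (p (head d) * t)) (W-suc-right l (head d) x)))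
    (factor-out Ds (λ d → δ y (tail d)) (p ∘ head) (λ d d′ → W l (head d) (tail d′)) (λ d′ → p (head d′) * δ (head d′) x))

  -- `W` charges `p` at every vertex of a walk but the starting one. The extra factor `p x`
  -- completes this to a product over all vertices, which does not see the direction of the walk.
  W-reversible : ∀ l x y → p x * W l x y ≡ p y * W l y x
  W-reversible zero x y = trans (*-comm (p x) (δ x y))
    (trans (δ-subst x y p) (trans (*-comm (δ x y) (p y)) (cong (p y *_) (δ-sym x y))))
  W-reversible (suc l) x y = begin
    p x * ∑ Ds (λ d → δ x (tail d) * (p (head d) * W l (head d) y))
      ≡⟨ ∑-*ˡ Ds (p x) _ ⟨
    ∑ Ds (λ d → p x * (δ x (tail d) * (p (head d) * W l (head d) y)))
      ≡⟨ ∑-cong Ds (λ d → step d) ⟩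
    ∑ Ds (λ d → p y * (W l y (head d) * (p (tail d) * δ (tail d) x)))
      ≡⟨ ∑-*ˡ Ds (p y) _ ⟩
    p y * ∑ Ds (λ d → W l y (head d) * (p (tail d) * δ (tail d) x))
      ≡⟨ cong (p y *_) (∑-cong Ds (λ d → cong₂ (λ t h → W l y t * (p h * δ h x)) (sym (tail-inv d)) (sym (head-inv d)))) ⟩
    p y * ∑ Ds (λ d → W l y (tail (inv d)) * (p (head (inv d)) * δ (head (inv d)) x))
      ≡⟨ cong (p y *_) (∑-inv (λ d → W l y (tail d) * (p (head d) * δ (head d) x))) ⟩
    p y * ∑ Ds (λ d → W l y (tail d) * (p (head d) * δ (head d) x))
      ≡⟨ cong (p y *_) (W-suc-right l y x) ⟨
    p y * W (suc l) y x ∎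
    where
    open ≡-Reasoning
    e₁ : ∀ a b c → a * (b * c) ≡ b * a * c
    e₁ = solve-∀
    e₂ : ∀ a b c d → a * b * (c * d) ≡ c * (d * (b * a))
    e₂ = solve-∀
    step : ∀ d → p x * (δ x (tail d) * (p (head d) * W l (head d) y)) ≡
                 p y * (W l y (head d) * (p (tail d) * δ (tail d) x))
    step d = begin
      p x * (δ x (tail d) * (p (head d) * W l (head d) y))   ≡⟨ e₁ (p x) (δ x (tail d)) _ ⟩
      δ x (tail d) * p x * (p (head d) * W l (head d) y)     ≡⟨ cong₂ _*_ (δ-subst x (tail d) p) (W-reversible l (head d) y) ⟩
      δ x (tail d) * p (tail d) * (p y * W l y (head d))     ≡⟨ cong (λ t → t * p (tail d) * (p y * W l y (head d))) (δ-sym x (tail d)) ⟩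
      δ (tail d) x * p (tail d) * (p y * W l y (head d))     ≡⟨ e₂ (δ (tail d) x) (p (tail d)) (p y) _ ⟩
      p y * (W l y (head d) * (p (tail d) * δ (tail d) x))   ∎

  -- Because `p` is charged at heads, `W l x y` is `Q ^ l` times a transition probability from `y`
  -- to `x`; hence it is the columns that have constant sum.
  W-column-sum : ∀ l {y} → y ∈ Vs → ∑ Vs (λ x → W l x y) ≡ Q ^ l
  W-column-sum zero    {y} y∈ = ∑δ-right y∈
  W-column-sum (suc l) {y} y∈ = begin
    ∑ Vs (λ x → ∑ Ds (λ d → δ x (tail d) * (p (head d) * W l (head d) y)))
      ≡⟨ ∑-swap Vs Ds _ ⟩
    ∑ Ds (λ d → ∑ Vs (λ x → δ x (tail d) * (p (head d) * W l (head d) y)))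
      ≡⟨ ∑-cong Ds (λ d → trans (∑-*ʳ Vs _ _) (trans (cong (_* (p (head d) * W l (head d) y)) (∑δ-right (tail∈ d))) (*-identityˡ _))) ⟩
    ∑ Ds (λ d → p (head d) * W l (head d) y)
      ≡⟨ ∑-head (λ x → p x * W l x y) ⟩
    ∑ Vs (λ x → deg x * (p x * W l x y))
      ≡⟨ ∑-deg-p (λ x → W l x y) ⟩
    Q * ∑ Vs (λ x → W l x y)
      ≡⟨ cong (Q *_) (W-column-sum l y∈) ⟩
    Q * Q ^ l ∎
    where open ≡-Reasoning

  instance
    Q≢0 : NonZero Q
    Q≢0 = >-nonZero Q>0

  p>0 : ∀ {x} → x ∈ Vs → 0 < p x
  p>0 {x} x∈ with p x | p*deg x∈
  ... | zero  | 0≡Q = contradiction 0≡Q (<⇒≢ Q>0)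
  ... | suc _ | _   = s≤s z≤n

  deg>0 : ∀ {x} → x ∈ Vs → 0 < deg x
  deg>0 {x} x∈ with deg x | p*deg x∈
  ... | zero  | eq = contradiction (trans (sym (*-zeroʳ (p x))) eq) (<⇒≢ Q>0)
  ... | suc _ | _  = s≤s z≤n

  -- H j is the trace of the 2j-th power of the walk operator.
  H : ℕ → ℕ
  H j = ∑ Vs (λ x → ∑ Vs (λ y → W j x y * W j y x))

  trace-W : ∀ i j → ∑ Vs (λ x → W (i + j) x x) ≡ ∑ Vs (λ x → ∑ Vs (λ y → W i x y * W j y x))
  trace-W i j = ∑-cong-∈ Vs (λ {x} x∈ → W-+ i j x x∈)

  H-0 : H 0 ≡ length Vs
  H-0 = begin
    H 0                    ≡⟨ trace-W 0 0 ⟨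
    ∑ Vs (λ x → δ x x)     ≡⟨ ∑-cong Vs (λ x → 𝟙-yes (x ≟ x) refl) ⟩
    ∑ Vs (λ x → 1)         ≡⟨ ∑-const Vs 1 ⟩
    length Vs * 1          ≡⟨ *-identityʳ _ ⟩
    length Vs              ∎
    where open ≡-Reasoning

  -- Conjugating by the square root of `p` would make the kernel symmetric. Transposing two factors
  -- at the same pair of vertices has the same effect without roots, since both sides pick up the
  -- factor `p x * p y`.
  W-exchange : ∀ i j {x y} → x ∈ Vs → y ∈ Vs → W i x y * W j y x ≡ W i y x * W j x y
  W-exchange i j {x} {y} x∈ y∈ =
    *-cancelˡ-≡ _ _ (p x * p y) {{m*n≢0 (p x) (p y) {{>-nonZero (p>0 x∈)}} {{>-nonZero (p>0 y∈)}}}} (begin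
      p x * p y * (W i x y * W j y x)     ≡⟨ e (p x) (p y) _ _ ⟩
      p x * W i x y * (p y * W j y x)     ≡⟨ cong₂ _*_ (W-reversible i x y) (W-reversible j y x) ⟩
      p y * W i y x * (p x * W j x y)     ≡⟨ e′ (p x) (p y) _ _ ⟩
      p x * p y * (W i y x * W j x y)     ∎)
    where
    open ≡-Reasoning
    e : ∀ a b c d → a * b * (c * d) ≡ a * c * (b * d)
    e = solve-∀
    e′ : ∀ a b c d → b * c * (a * d) ≡ a * b * (c * d)
    e′ = solve-∀

  -- Splitting `2j + 2` as `j + (j + 2)` instead of evenly presents the trace as the inner product
  -- of the symmetrised j-th and (j+2)-th powers; `H j` and `H (j + 2)` are their squared norms.
  H-log-convex : ∀ j → H (suc j) * H (suc j) ≤ H j * H (suc (suc j))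
  H-log-convex j = begin
    H (suc j) * H (suc j)  ≡⟨ cong₂ _*_ mixed mixed ⟩
    tr * tr                ≤⟨ cauchy-schwarz Vs _ _ _ (λ x∈ → cauchy-schwarz Vs _ _ _ (λ y∈ → ≤-reflexive (pointwise x∈ y∈))) ⟩
    H j * H (suc (suc j))  ∎
    where
    open ≤-Reasoning
    tr = ∑ Vs (λ x → ∑ Vs (λ y → W j x y * W (suc (suc j)) y x))
    mixed : H (suc j) ≡ tr
    mixed = trans (sym (trace-W (suc j) (suc j)))
      (trans (cong (λ m → ∑ Vs (λ x → W m x x)) (sym (+-suc j (suc j)))) (trace-W j (suc (suc j))))
    e : ∀ a b c d → a * d * (b * c) ≡ a * b * (c * d)
    e = solve-∀
    pointwise : ∀ {x y} → x ∈ Vs → y ∈ Vs →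
      let c = W j x y * W (suc (suc j)) y x in
      c * c ≡ (W j x y * W j y x) * (W (suc (suc j)) x y * W (suc (suc j)) y x)
    pointwise {x} {y} x∈ y∈ = trans
      (cong (W j x y * W (suc (suc j)) y x *_) (W-exchange j (suc (suc j)) x∈ y∈))
      (e (W j x y) (W j y x) (W (suc (suc j)) x y) (W (suc (suc j)) y x))

  module _ (x₀ : V) (x₀∈ : x₀ ∈ Vs) where

    -- The trace is at least the contribution of the eigenvalue `Q`, whose eigenvector is `deg`. In
    -- place of spectral theory, Cauchy-Schwarz is applied against the rank-one kernel
    -- `deg x * deg y`, with detailed balance turning the square of `W j x y * deg y` into a term of
    -- `H j`.
    H-lower : ∀ j → Q ^ (j + j) ≤ H j
    H-lower j = *-cancelʳ-≤ (Q ^ (j + j)) (H j) (m * m) {{m*n≢0 m m}} (begin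
      Q ^ (j + j) * (m * m)        ≡⟨ cong (_* (m * m)) (^-distribˡ-+-* Q j j) ⟩
      Q ^ j * Q ^ j * (m * m)      ≡⟨ e (Q ^ j) m ⟩
      Q ^ j * m * (Q ^ j * m)      ≡⟨ cong₂ _*_ total total ⟨
      C * C                        ≤⟨ cauchy-schwarz Vs _ _ _ (λ x∈ → cauchy-schwarz Vs _ _ _ (λ y∈ → ≤-reflexive (pointwise x∈ y∈))) ⟩
      H j * ∑ Vs (λ x → ∑ Vs (λ y → deg x * deg y))
                                   ≡⟨ cong (H j *_) (trans (∑-cong Vs (λ x → ∑-*ˡ Vs (deg x) deg)) (∑-*ʳ Vs m deg)) ⟩
      H j * (m * m)                ∎)
      where
      open ≤-Reasoning
      m = ∑ Vs deg
      C = ∑ Vs (λ x → ∑ Vs (λ y → W j x y * deg y))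
      instance
        m≢0 : NonZero m
        m≢0 = >-nonZero (≤-trans (deg>0 x₀∈) (term≤∑ deg x₀∈))
      e : ∀ a b → a * a * (b * b) ≡ a * b * (a * b)
      e = solve-∀
      total : C ≡ Q ^ j * m
      total = trans (∑-swap Vs Vs _)
        (trans (∑-cong-∈ Vs (λ {y} y∈ → trans (∑-*ʳ Vs (deg y) _) (cong (_* deg y) (W-column-sum j y∈))))
               (∑-*ˡ Vs (Q ^ j) deg))
      detailed-balance : ∀ {x y} → x ∈ Vs → y ∈ Vs → W j x y * deg y ≡ W j y x * deg x
      detailed-balance {x} {y} x∈ y∈ = *-cancelˡ-≡ _ _ Q (begin-equality
        Q * (W j x y * deg y)                 ≡⟨ cong (_* (W j x y * deg y)) (p*deg x∈) ⟨
        p x * deg x * (W j x y * deg y)       ≡⟨ e₁ (p x) (deg x) (W j x y) (deg y) ⟩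
        p x * W j x y * (deg x * deg y)       ≡⟨ cong (_* (deg x * deg y)) (W-reversible j x y) ⟩
        p y * W j y x * (deg x * deg y)       ≡⟨ e₂ (p y) (deg x) (W j y x) (deg y) ⟩
        p y * deg y * (W j y x * deg x)       ≡⟨ cong (_* (W j y x * deg x)) (p*deg y∈) ⟩
        Q * (W j y x * deg x)                 ∎)
        where
        e₁ : ∀ a b c d → a * b * (c * d) ≡ a * c * (b * d)
        e₁ = solve-∀
        e₂ : ∀ a b c d → a * c * (b * d) ≡ a * d * (c * b)
        e₂ = solve-∀
      pointwise : ∀ {x y} → x ∈ Vs → y ∈ Vs →
        W j x y * deg y * (W j x y * deg y) ≡ W j x y * W j y x * (deg x * deg y)
      pointwise {x} {y} x∈ y∈ = trans (cong (W j x y * deg y *_) (detailed-balance x∈ y∈))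
                                      (e₁ (W j x y) (W j y x) (deg x) (deg y))
        where
        e₁ : ∀ a b c d → a * d * (b * c) ≡ a * b * (c * d)
        e₁ = solve-∀

    H>0 : ∀ j → 0 < H j
    H>0 j = ≤-trans (m^n>0 Q (j + j)) (H-lower j)

    -- Interpolation of the log-convex `H` between 0 and `suc l`, raised to a power to avoid roots;
    -- the factor `length Vs` is `H 0`. The induction step divides by a power of `H (suc l)`, whence
    -- the need for positivity.
    H-power-mean : ∀ l → H l ^ suc l ≤ length Vs * H (suc l) ^ l
    H-power-mean zero = ≤-reflexive (cong (_* 1) H-0)
    H-power-mean (suc l) = *-cancelˡ-≤ (b ^ l) {{m^n≢0 b l}} (begin
      b ^ l * (b * (b * b ^ l))         ≡⟨ e₁ (b ^ l) b ⟩
      b * b ^ l * (b * b ^ l)           ≡⟨ ^-distribʳ-* b b (suc l) ⟨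
      (b * b) ^ suc l                   ≤⟨ ^-monoˡ-≤ (suc l) (H-log-convex l) ⟩
      (a * c) ^ suc l                   ≡⟨ ^-distribʳ-* a c (suc l) ⟩
      a ^ suc l * c ^ suc l             ≤⟨ *-monoˡ-≤ (c ^ suc l) (H-power-mean l) ⟩
      n * b ^ l * c ^ suc l             ≡⟨ e₂ n (b ^ l) (c ^ suc l) ⟩
      b ^ l * (n * c ^ suc l)           ∎)
      where
      open ≤-Reasoning
      a = H l
      b = H (suc l)
      c = H (suc (suc l))
      n = length Vs
      instance
        b≢0 : NonZero b
        b≢0 = >-nonZero (H>0 (suc l))
      e₁ : ∀ z b → z * (b * (b * z)) ≡ b * z * (b * z)
      e₁ = solve-∀
      e₂ : ∀ n z c → n * z * c ≡ z * (n * c)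
      e₂ = solve-∀

  -- Weights of individual closed walks.

  link : D → D → ℕ
  link d d′ = δ (head d) (tail d′) * p (head d)

  chain : D → List D → D → ℕ
  chain d []       z = link d z
  chain d (d′ ∷ v) z = link d d′ * chain d′ v z

  -- A cyclic product: the last dart is linked back to the first, so nonzero weight means that the
  -- word is a closed walk, and rotations keep the weight.
  weight : List D → ℕ
  weight []      = 0
  weight (d ∷ v) = chain d v d

  chain-snoc : ∀ d v z′ z → chain d (v ++ z′ ∷ []) z ≡ chain d v z′ * link z′ z
  chain-snoc d []       z′ z = refl
  chain-snoc d (d′ ∷ v) z′ z = trans (cong (link d d′ *_) (chain-snoc d′ v z′ z))
                                     (sym (*-assoc (link d d′) _ _))

  weight-rotate : ∀ s → weight (rotate s) ≡ weight s
  weight-rotate []           = refl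
  weight-rotate (d ∷ [])     = refl
  weight-rotate (d ∷ d′ ∷ v) = trans (chain-snoc d′ v d d′) (*-comm (chain d′ v d) (link d d′))

  weight-rotates : ∀ i s → weight (rotates i s) ≡ weight s
  weight-rotates zero    s = refl
  weight-rotates (suc i) s = trans (weight-rotates i (rotate s)) (weight-rotate s)

  weight≢0⇒linked : ∀ d d′ v → ¬ weight (d ∷ d′ ∷ v) ≡ 0 → head d ≡ tail d′
  weight≢0⇒linked d d′ v w≢0 with head d ≟ tail d′
  ... | yes eq = eq
  ... | no  _  = contradiction refl w≢0

  pathWeight : V → List D → V → ℕ
  pathWeight x []      y = δ x y
  pathWeight x (d ∷ v) y = δ x (tail d) * (p (head d) * pathWeight (head d) v y)

  chain-pathWeight : ∀ d v z → chain d v z ≡ p (head d) * pathWeight (head d) v (tail z)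
  chain-pathWeight d []       z = *-comm (δ (head d) (tail z)) (p (head d))
  chain-pathWeight d (d′ ∷ v) z = trans
    (cong₂ _*_ (*-comm (δ (head d) (tail d′)) (p (head d))) (chain-pathWeight d′ v z))
    (*-assoc (p (head d)) (δ (head d) (tail d′)) _)

  W-words : ∀ l x y → ∑ (words Ds l) (λ v → pathWeight x v y) ≡ W l x y
  W-words zero    x y = +-identityʳ _
  W-words (suc l) x y = trans (∑-words-suc Ds l (λ v → pathWeight x v y))
    (∑-cong Ds (λ d → trans (∑-*ˡ (words Ds l) (δ x (tail d)) _)
      (cong (δ x (tail d) *_) (trans (∑-*ˡ (words Ds l) (p (head d)) _)
        (cong (p (head d) *_) (W-words l (head d) y))))))

  pathWeight-++ : ∀ u v {x} z → x ∈ Vs →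
    pathWeight x (u ++ v) z ≡ ∑ Vs (λ y → pathWeight x u y * pathWeight y v z)
  pathWeight-++ []      v     z x∈ = sym (∑δ x∈ (λ y → pathWeight y v z))
  pathWeight-++ (d ∷ u) v {x} z x∈ = begin
    a * (b * pathWeight (head d) (u ++ v) z)
      ≡⟨ cong (λ t → a * (b * t)) (pathWeight-++ u v z (head∈ d)) ⟩
    a * (b * ∑ Vs (λ y → pathWeight (head d) u y * pathWeight y v z))
      ≡⟨ sym (trans (∑-*ˡ Vs a _) (cong (a *_) (∑-*ˡ Vs b _))) ⟩
    ∑ Vs (λ y → a * (b * (pathWeight (head d) u y * pathWeight y v z)))
      ≡⟨ ∑-cong Vs (λ y → e a b (pathWeight (head d) u y) (pathWeight y v z)) ⟩
    ∑ Vs (λ y → a * (b * pathWeight (head d) u y) * pathWeight y v z) ∎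
    where
    open ≡-Reasoning
    a = δ x (tail d)
    b = p (head d)
    e : ∀ a b c r → a * (b * (c * r)) ≡ a * (b * c) * r
    e = solve-∀

  total-weight : ∀ l → ∑ (words Ds (suc l)) weight ≡ ∑ Vs (λ x → W (suc l) x x)
  total-weight l = begin
    ∑ (words Ds (suc l)) weight
      ≡⟨ ∑-words-suc Ds l weight ⟩
    ∑ Ds (λ d → ∑ (words Ds l) (λ v → chain d v d))
      ≡⟨ ∑-cong Ds (λ d → trans (∑-cong (words Ds l) (λ v → chain-pathWeight d v d))
           (trans (∑-*ˡ (words Ds l) (p (head d)) _) (cong (p (head d) *_) (W-words l (head d) (tail d))))) ⟩
    ∑ Ds (λ d → p (head d) * W l (head d) (tail d))
      ≡⟨ ∑-cong Ds (λ d → ∑δ (tail∈ d) (λ x → p (head d) * W l (head d) x)) ⟨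
    ∑ Ds (λ d → ∑ Vs (λ x → δ (tail d) x * (p (head d) * W l (head d) x)))
      ≡⟨ ∑-swap Ds Vs _ ⟩
    ∑ Vs (λ x → ∑ Ds (λ d → δ (tail d) x * (p (head d) * W l (head d) x)))
      ≡⟨ ∑-cong Vs (λ x → ∑-cong Ds (λ d → cong (_* (p (head d) * W l (head d) x)) (δ-sym (tail d) x))) ⟩
    ∑ Vs (λ x → W (suc l) x x) ∎
    where open ≡-Reasoning

  total-weight-H : ∀ l → ∑ (words Ds (suc (suc l + l))) weight ≡ H (suc l)
  total-weight-H l = trans (total-weight (suc l + l))
    (trans (cong (λ m → ∑ Vs (λ x → W m x x)) (sym (+-suc (suc l) l))) (trace-W (suc l) (suc l)))

  -- The total weight of closed walks containing a conflict.

  module Conflicts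
    (Conf : D → D → Set) (conf? : ∀ d f → Dec (Conf d f))
    (σ : ℕ) (conf-bound : ∀ x f → ∑ Ds (λ d → δ (head d) x * 𝟙 (conf? d f)) ≤ σ)
    (pmax : ℕ) (p≤pmax : ∀ x → p x ≤ pmax)
    where

    conflict : D → List D → ℕ
    conflict d u = 𝟙 (any? (conf? d) u)

    bad : ℕ → List D → ℕ
    bad k []      = 0
    bad k (d ∷ v) = conflict d (take k v)

    conflict≤∑ : ∀ d u → conflict d u ≤ ∑ u (λ f → 𝟙 (conf? d f))
    conflict≤∑ d []      = z≤n
    conflict≤∑ d (f ∷ u) with conf? d f | conflict≤∑ d u
    ... | yes _ | _  = s≤s z≤n
    ... | no  _ | ih with any? (conf? d) u
    ... | yes _ = ih
    ... | no  _ = ih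

    conflict-degree : ∀ x u → ∑ Ds (λ d → δ (head d) x * conflict d u) ≤ length u * σ
    conflict-degree x u = begin
      ∑ Ds (λ d → δ (head d) x * conflict d u)
        ≤⟨ ∑-mono Ds (λ d → *-monoʳ-≤ (δ (head d) x) (conflict≤∑ d u)) ⟩
      ∑ Ds (λ d → δ (head d) x * ∑ u (λ f → 𝟙 (conf? d f)))
        ≡⟨ ∑-cong Ds (λ d → ∑-*ˡ u (δ (head d) x) _) ⟨
      ∑ Ds (λ d → ∑ u (λ f → δ (head d) x * 𝟙 (conf? d f)))
        ≡⟨ ∑-swap Ds u _ ⟩
      ∑ u (λ f → ∑ Ds (λ d → δ (head d) x * 𝟙 (conf? d f)))
        ≤⟨ ∑-mono u (conf-bound x) ⟩
      ∑ u (λ _ → σ)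
        ≡⟨ ∑-const u σ ⟩
      length u * σ ∎
      where open ≤-Reasoning

    badTotal : ℕ → ℕ → ℕ
    badTotal k l = ∑ (words Ds (suc (k + l))) (λ s → bad k s * weight s)

    module _ (k l : ℕ) where

      S : D → V → ℕ
      S d y = ∑ (words Ds k) (λ u → conflict d u * pathWeight (head d) u y)

      S≤W : ∀ d y → S d y ≤ W k (head d) y
      S≤W d y = ≤-trans (∑-mono (words Ds k) (λ u → ≤-trans
          (*-monoˡ-≤ (pathWeight (head d) u y) (𝟙≤1 (any? (conf? d) u)))
          (≤-reflexive (*-identityˡ _))))
        (≤-reflexive (W-words k (head d) y))

      -- A conflict involves only the first dart and the long arc from its head to `y`. The short
      -- arc from `y` back to its tail is therefore unconstrained and sums to `W l`.
      badTotal-split : badTotal k l ≡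
        ∑ Ds (λ d → ∑ Vs (λ y → p (head d) * S d y * W l y (tail d)))
      badTotal-split = trans (∑-words-suc Ds (k + l) _) (∑-cong Ds split)
        where
        open ≡-Reasoning
        wk = words Ds k
        wl = words Ds l
        e : ∀ a b c r → a * (b * (c * r)) ≡ b * (a * c) * r
        e = solve-∀
        split : ∀ d → ∑ (words Ds (k + l)) (λ v → conflict d (take k v) * chain d v d) ≡
                      ∑ Vs (λ y → p (head d) * S d y * W l y (tail d))
        split d = begin
          ∑ (words Ds (k + l)) (λ v → conflict d (take k v) * chain d v d)
            ≡⟨ ∑-words-+ Ds k l _ ⟩
          ∑ wk (λ u → ∑ wl (λ v → conflict d (take k (u ++ v)) * chain d (u ++ v) d))
            ≡⟨ ∑-cong-∈ wk (λ {u} u∈ → ∑-cong wl (λ v → cong₂ _*_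
                 (cong (conflict d) (trans (cong (λ m → take m (u ++ v)) (sym (length-words Ds k u∈)))
                                           (take-length-++ u v)))
                 (trans (chain-pathWeight d (u ++ v) d)
                        (cong (b *_) (pathWeight-++ u v (tail d) (head∈ d)))))) ⟩
          ∑ wk (λ u → ∑ wl (λ v → a u * (b * ∑ Vs (λ y → P u y * R y v))))
            ≡⟨ ∑-cong wk (λ u → ∑-cong wl (λ v → trans
                 (sym (trans (∑-*ˡ Vs (a u) _) (cong (a u *_) (∑-*ˡ Vs b _))))
                 (∑-cong Vs (λ y → e (a u) b (P u y) (R y v))))) ⟩
          ∑ wk (λ u → ∑ wl (λ v → ∑ Vs (λ y → b * (a u * P u y) * R y v)))
            ≡⟨ ∑-cong wk (λ u → ∑-swap wl Vs _) ⟩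
          ∑ wk (λ u → ∑ Vs (λ y → ∑ wl (λ v → b * (a u * P u y) * R y v)))
            ≡⟨ ∑-cong wk (λ u → ∑-cong Vs (λ y → trans (∑-*ˡ wl (b * (a u * P u y)) _)
                 (cong (b * (a u * P u y) *_) (W-words l y (tail d))))) ⟩
          ∑ wk (λ u → ∑ Vs (λ y → b * (a u * P u y) * W l y (tail d)))
            ≡⟨ ∑-swap wk Vs _ ⟩
          ∑ Vs (λ y → ∑ wk (λ u → b * (a u * P u y) * W l y (tail d)))
            ≡⟨ ∑-cong Vs (λ y → trans (∑-*ʳ wk (W l y (tail d)) _)
                 (cong (_* W l y (tail d)) (∑-*ˡ wk b _))) ⟩
          ∑ Vs (λ y → b * S d y * W l y (tail d)) ∎
          where
          a = conflict d
          b = p (head d)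
          P = pathWeight (head d)
          R : V → List D → ℕ
          R y v = pathWeight y v (tail d)

      -- Compare the return weight w = W k y x₁ along the long arc with the weight
      -- v = W l y x₀ of the short one.  If w dominates, only conflicting first edges are paid
      -- for; otherwise the conflict is forgotten and w is traded for v.
      pointwise : ∀ c d y →
        c * (p (head d) * S d y * W l y (tail d)) ≤
        S d y * W k y (head d) + c * c * pmax * (p y * (W l y (tail d) * W l y (tail d)))
      pointwise c d y with c * pmax * W l y (tail d) ≤? W k y (head d)
      ... | yes short≤long = ≤-trans (begin
        c * (p (head d) * S d y * v)      ≡⟨ e₁ c (p (head d)) (S d y) v ⟩
        S d y * (c * p (head d) * v)      ≤⟨ *-monoʳ-≤ (S d y) (*-monoˡ-≤ v (*-monoʳ-≤ c (p≤pmax (head d)))) ⟩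
        S d y * (c * pmax * v)            ≤⟨ *-monoʳ-≤ (S d y) short≤long ⟩
        S d y * W k y (head d)            ∎) (m≤m+n _ _)
        where
        open ≤-Reasoning
        v = W l y (tail d)
        e₁ : ∀ c b s v → c * (b * s * v) ≡ s * (c * b * v)
        e₁ = solve-∀
      ... | no short≰long = ≤-trans (begin
        c * (p (head d) * S d y * v)              ≤⟨ *-monoʳ-≤ c (*-monoˡ-≤ v (*-monoʳ-≤ (p (head d)) (S≤W d y))) ⟩
        c * (p (head d) * W k (head d) y * v)     ≡⟨ cong (λ t → c * (t * v)) (W-reversible k (head d) y) ⟩
        c * (p y * W k y (head d) * v)            ≤⟨ *-monoʳ-≤ c (*-monoˡ-≤ v (*-monoʳ-≤ (p y) (<⇒≤ (≰⇒> short≰long)))) ⟩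
        c * (p y * (c * pmax * v) * v)            ≡⟨ e₂ c (p y) pmax v ⟩
        c * c * pmax * (p y * (v * v))            ∎) (m≤n+m _ _)
        where
        open ≤-Reasoning
        v = W l y (tail d)
        e₂ : ∀ c b m v → c * (b * (c * m * v) * v) ≡ c * c * m * (b * (v * v))
        e₂ = solve-∀

      -- With the arc `u` out of `x` fixed, at most `k * σ` darts into `x` conflict with it. The sum
      -- over the first dart thus costs this factor instead of `deg x`, and two arcs of length `k`
      -- between `x` and `y` remain.
      conflicting-part : ∑ Ds (λ d → ∑ Vs (λ y → S d y * W k y (head d))) ≤ k * σ * H k
      conflicting-part = begin
        ∑ Ds (λ d → ∑ Vs (λ y → S d y * W k y (head d)))
          ≡⟨ ∑-cong Ds (λ d → ∑δ (head∈ d) (G d)) ⟨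
        ∑ Ds (λ d → ∑ Vs (λ x → δ (head d) x * G d x))
          ≡⟨ ∑-swap Ds Vs _ ⟩
        ∑ Vs (λ x → ∑ Ds (λ d → δ (head d) x * G d x))
          ≤⟨ ∑-mono Vs inner ⟩
        ∑ Vs (λ x → k * σ * ∑ Vs (λ y → W k x y * W k y x))
          ≡⟨ ∑-*ˡ Vs (k * σ) _ ⟩
        k * σ * H k ∎
        where
        open ≤-Reasoning
        wk = words Ds k
        G : D → V → ℕ
        G d x = ∑ Vs (λ y → ∑ wk (λ u → conflict d u * pathWeight x u y) * W k y x)
        e : ∀ a b c r → a * (b * c * r) ≡ a * b * (c * r)
        e = solve-∀
        inner : ∀ x → ∑ Ds (λ d → δ (head d) x * G d x) ≤
                      k * σ * ∑ Vs (λ y → W k x y * W k y x)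
        inner x = begin
          ∑ Ds (λ d → δ (head d) x * G d x)
            ≡⟨ ∑-cong Ds (λ d → trans (sym (∑-*ˡ Vs (δ (head d) x) _)) (∑-cong Vs (λ y →
                 trans (cong (δ (head d) x *_) (sym (∑-*ʳ wk (W k y x) _)))
                 (trans (sym (∑-*ˡ wk (δ (head d) x) _))
                        (∑-cong wk (λ u → e (δ (head d) x) (conflict d u) (pathWeight x u y) (W k y x))))))) ⟩
          ∑ Ds (λ d → ∑ Vs (λ y → ∑ wk (λ u → δ (head d) x * conflict d u * (pathWeight x u y * W k y x))))
            ≡⟨ ∑-swap Ds Vs _ ⟩
          ∑ Vs (λ y → ∑ Ds (λ d → ∑ wk (λ u → δ (head d) x * conflict d u * (pathWeight x u y * W k y x))))
            ≡⟨ ∑-cong Vs (λ y → trans (∑-swap Ds wk _) (∑-cong wk (λ u → ∑-*ʳ Ds (pathWeight x u y * W k y x) _))) ⟩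
          ∑ Vs (λ y → ∑ wk (λ u → ∑ Ds (λ d → δ (head d) x * conflict d u) * (pathWeight x u y * W k y x)))
            ≤⟨ ∑-mono Vs (λ y → ∑-mono-∈ wk (λ {u} u∈ → *-monoˡ-≤ (pathWeight x u y * W k y x)
                 (≤-trans (conflict-degree x u) (≤-reflexive (cong (_* σ) (length-words Ds k u∈)))))) ⟩
          ∑ Vs (λ y → ∑ wk (λ u → k * σ * (pathWeight x u y * W k y x)))
            ≡⟨ ∑-cong Vs (λ y → trans (∑-*ˡ wk (k * σ) _) (cong (k * σ *_)
                 (trans (∑-*ʳ wk (W k y x) _) (cong (_* W k y x) (W-words k x y))))) ⟩
          ∑ Vs (λ y → k * σ * (W k x y * W k y x))
            ≡⟨ ∑-*ˡ Vs (k * σ) _ ⟩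
          k * σ * ∑ Vs (λ y → W k x y * W k y x) ∎

      -- The first dart is now summed freely. Reversibility moves the factor `p` from `y` to the
      -- tail of that dart, where it cancels against the degree and leaves `Q`.
      forgotten-part : ∑ Ds (λ d → ∑ Vs (λ y → p y * (W l y (tail d) * W l y (tail d)))) ≡ Q * H l
      forgotten-part = begin
        ∑ Ds (λ d → ∑ Vs (λ y → p y * (W l y (tail d) * W l y (tail d))))
          ≡⟨ ∑-tail (λ x → ∑ Vs (λ y → p y * (W l y x * W l y x))) ⟩
        ∑ Vs (λ x → deg x * ∑ Vs (λ y → p y * (W l y x * W l y x)))
          ≡⟨ ∑-cong Vs (λ x → cong (deg x *_) (trans (∑-cong Vs (step x)) (∑-*ˡ Vs (p x) _))) ⟩
        ∑ Vs (λ x → deg x * (p x * ∑ Vs (λ y → W l x y * W l y x)))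
          ≡⟨ ∑-deg-p _ ⟩
        Q * H l ∎
        where
        open ≡-Reasoning
        step : ∀ x y → p y * (W l y x * W l y x) ≡ p x * (W l x y * W l y x)
        step x y = trans (sym (*-assoc (p y) (W l y x) (W l y x)))
          (trans (cong (_* W l y x) (W-reversible l y x)) (*-assoc (p x) (W l x y) (W l y x)))

      badTotal-bound : ∀ c → c * badTotal k l ≤ k * σ * H k + c * c * pmax * (Q * H l)
      badTotal-bound c = begin
        c * badTotal k l
          ≡⟨ cong (c *_) badTotal-split ⟩
        c * ∑ Ds (λ d → ∑ Vs (λ y → p (head d) * S d y * W l y (tail d)))
          ≡⟨ trans (sym (∑-*ˡ Ds c _)) (∑-cong Ds (λ d → sym (∑-*ˡ Vs c _))) ⟩
        ∑ Ds (λ d → ∑ Vs (λ y → c * (p (head d) * S d y * W l y (tail d))))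
          ≤⟨ ∑-mono Ds (λ d → ∑-mono Vs (pointwise c d)) ⟩
        ∑ Ds (λ d → ∑ Vs (λ y → S d y * W k y (head d) + C * R d y))
          ≡⟨ trans (∑-cong Ds (λ d → ∑-+ Vs _ _)) (∑-+ Ds _ _) ⟩
        ∑ Ds (λ d → ∑ Vs (λ y → S d y * W k y (head d))) + ∑ Ds (λ d → ∑ Vs (λ y → C * R d y))
          ≤⟨ +-mono-≤ conflicting-part (≤-reflexive (trans (∑-cong Ds (λ d → ∑-*ˡ Vs C (R d)))
               (trans (∑-*ˡ Ds C _) (cong (C *_) forgotten-part)))) ⟩
        k * σ * H k + C * (Q * H l) ∎
        where
        open ≤-Reasoning
        C = c * c * pmax
        R : D → V → ℕ
        R d y = p y * (W l y (tail d) * W l y (tail d))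

    chain≤ : ∀ d v z → chain d v z ≤ pmax ^ suc (length v)
    chain≤ d v z = go d v
      where
      link≤ : ∀ d d′ → link d d′ ≤ pmax
      link≤ d d′ = ≤-trans (*-mono-≤ (𝟙≤1 (head d ≟ tail d′)) (p≤pmax (head d)))
                           (≤-reflexive (*-identityˡ pmax))
      go : ∀ d v → chain d v z ≤ pmax ^ suc (length v)
      go d []       = ≤-trans (link≤ d z) (≤-reflexive (sym (*-identityʳ pmax)))
      go d (d′ ∷ v) = *-mono-≤ (link≤ d d′) (go d′ v)

    weight≤ : ∀ s → weight s ≤ pmax ^ length s
    weight≤ []      = z≤n
    weight≤ (d ∷ v) = chain≤ d v d

    -- Absorbing the bad walks and counting what remains.

    module _ (l : ℕ) (σ>0 : 0 < σ) (x₀ : V) (x₀∈ : x₀ ∈ Vs)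
      (D₀ : ℕ) (D₀-large : 64 * σ * (suc l * suc l * suc l) ≤ D₀)
      (pmax-small : D₀ ^ suc l * length Vs * pmax ^ suc l ≤ Q ^ suc l)
      (found : List D → ℕ)
      (cover : ∀ s → length s ≡ suc (suc l + l) → ¬ (weight s ≡ 0) →
               (∀ i → i < suc (suc l + l) → bad (suc l) (rotates i s) ≡ 0) → 1 ≤ found s)
      where
      private
        k = suc l
        M = suc (k + l)
        n = length Vs

      M≡k+k : M ≡ k + k
      M≡k+k = sym (+-suc k l)

      weight-cover : ∀ s → length s ≡ M →
        weight s ≤ pmax ^ M * found s + ∑ (upTo M) (λ i → bad k (rotates i s) * weight (rotates i s))
      weight-cover s s≡M = covered-≤ M (λ i → bad k (rotates i s)) (λ i → weight (rotates i s)) (weight s)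
        (pmax ^ M * found s) (λ i → weight-rotates i s) (λ w≢0 good → begin
          weight s                ≤⟨ weight≤ s ⟩
          pmax ^ length s         ≡⟨ cong (pmax ^_) s≡M ⟩
          pmax ^ M                ≡⟨ *-identityʳ _ ⟨
          pmax ^ M * 1            ≤⟨ *-monoʳ-≤ (pmax ^ M) (cover s s≡M w≢0 good) ⟩
          pmax ^ M * found s      ∎)
        where open ≤-Reasoning

      -- Rotation permutes the words, so each of the `k + k` rotations contributes the same
      -- `badTotal`.
      H≤found+bad : H k ≤ pmax ^ M * ∑ (words Ds M) found + (k + k) * badTotal k l
      H≤found+bad = begin
        H k
          ≡⟨ total-weight-H l ⟨
        ∑ ws weight
          ≤⟨ ∑-mono-∈ ws (λ {s} s∈ → weight-cover s (length-words Ds M s∈)) ⟩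
        ∑ ws (λ s → pmax ^ M * found s + ∑ (upTo M) (λ i → B (rotates i s)))
          ≡⟨ ∑-+ ws _ _ ⟩
        ∑ ws (λ s → pmax ^ M * found s) + ∑ ws (λ s → ∑ (upTo M) (λ i → B (rotates i s)))
          ≡⟨ cong₂ _+_ (∑-*ˡ ws (pmax ^ M) found) (trans (∑-swap ws (upTo M) _)
               (trans (∑-cong (upTo M) (λ i → ∑-words-rotates Ds M i B)) (∑-const (upTo M) (badTotal k l)))) ⟩
        pmax ^ M * ∑ ws found + length (upTo M) * badTotal k l
          ≡⟨ cong (λ m → pmax ^ M * ∑ ws found + m * badTotal k l) (trans (length-upTo M) M≡k+k) ⟩
        pmax ^ M * ∑ ws found + (k + k) * badTotal k l ∎
        where
        open ≤-Reasoning
        ws = words Ds M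
        B : List D → ℕ
        B s = bad k s * weight s

      -- Normalised, `pmax` is at most n^(-1/k) / D₀ and `H l` is at most n^(1/k) times a power of
      -- `H k`. Taking k-th powers makes both roots of n integral and cancels them; the surplus
      -- `Q ^ (k + k)` is then bounded by one factor `H k`.
      H-ratio : 64 * σ * (k * k * k) * (pmax * (Q * H l)) ≤ H k
      H-ratio = ^-cancelˡ-≤ k _ _ (begin
        (64 * σ * (k * k * k) * (pmax * (Q * H l))) ^ k       ≤⟨ ^-monoˡ-≤ k (*-monoˡ-≤ (pmax * (Q * H l)) D₀-large) ⟩
        (D₀ * (pmax * (Q * H l))) ^ k                         ≡⟨ trans (^-distribʳ-* D₀ _ k) (cong (D₀ ^ k *_) (trans (^-distribʳ-* pmax _ k) (cong (pmax ^ k *_) (^-distribʳ-* Q (H l) k)))) ⟩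
        D₀ ^ k * (pmax ^ k * (Q ^ k * H l ^ k))               ≤⟨ *-monoʳ-≤ (D₀ ^ k) (*-monoʳ-≤ (pmax ^ k) (*-monoʳ-≤ (Q ^ k) (H-power-mean x₀ x₀∈ l))) ⟩
        D₀ ^ k * (pmax ^ k * (Q ^ k * (n * H k ^ l)))         ≡⟨ e (D₀ ^ k) (pmax ^ k) (Q ^ k) n (H k ^ l) ⟩
        D₀ ^ k * n * pmax ^ k * Q ^ k * H k ^ l               ≤⟨ *-monoˡ-≤ (H k ^ l) (*-monoˡ-≤ (Q ^ k) pmax-small) ⟩
        Q ^ k * Q ^ k * H k ^ l                               ≡⟨ cong (_* H k ^ l) (^-distribˡ-+-* Q k k) ⟨
        Q ^ (k + k) * H k ^ l                                 ≤⟨ *-monoˡ-≤ (H k ^ l) (H-lower x₀ x₀∈ k) ⟩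
        H k ^ k                                               ∎)
        where
        open ≤-Reasoning
        e : ∀ a b c n h → a * (b * (c * (n * h))) ≡ a * n * b * c * h
        e = solve-∀

      H≤2found : H k ≤ 2 * (pmax ^ M * ∑ (words Ds M) found)
      H≤2found = absorb-bad k σ (H k) (pmax ^ M * ∑ (words Ds M) found) (badTotal k l) (pmax * (Q * H l)) c refl c>0
        H≤found+bad
        (≤-trans (badTotal-bound k l c) (≤-reflexive (cong (k * σ * H k +_) (*-assoc (c * c) pmax (Q * H l)))))
        (≤-trans (≤-reflexive (cong (_* (pmax * (Q * H l))) (e k σ))) H-ratio)
        where
        -- For this `c` the smallness condition of `absorb-bad` has coefficient `8 * k * c`, which
        -- is the `64 * σ * k³` demanded of `D₀`.
        c = 8 * (σ * (k * k))
        c>0 : 0 < c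
        c>0 = *-mono-≤ {1} {8} (s≤s z≤n) (*-mono-≤ {1} {σ} σ>0 (s≤s z≤n))
        e : ∀ k σ → 8 * k * (8 * (σ * (k * k))) ≡ 64 * σ * (k * k * k)
        e = solve-∀

      D₀>0 : 0 < D₀
      D₀>0 = ≤-trans (*-mono-≤ {1} {64 * σ} {1} (*-mono-≤ {1} {64} (s≤s z≤n) σ>0) (s≤s z≤n)) D₀-large

      n*pmax^k≤Q^k : n * pmax ^ k ≤ Q ^ k
      n*pmax^k≤Q^k = ≤-trans
        (≤-trans (m≤n*m (n * pmax ^ k) (D₀ ^ k) {{m^n≢0 D₀ k {{>-nonZero D₀>0}}}})
                 (≤-reflexive (sym (*-assoc (D₀ ^ k) n (pmax ^ k)))))
        pmax-small

      supersaturation : n * n ≤ 2 * ∑ (words Ds M) found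
      supersaturation = *-cancelʳ-≤ (n * n) (2 * F) (Q ^ (k + k)) {{m^n≢0 Q (k + k)}} (begin
        n * n * Q ^ (k + k)                        ≤⟨ *-monoʳ-≤ (n * n) (H-lower x₀ x₀∈ k) ⟩
        n * n * H k                                ≤⟨ *-monoʳ-≤ (n * n) H≤2found ⟩
        n * n * (2 * (pmax ^ M * F))               ≡⟨ cong (λ m → n * n * (2 * (pmax ^ m * F))) M≡k+k ⟩
        n * n * (2 * (pmax ^ (k + k) * F))         ≡⟨ cong (λ t → n * n * (2 * (t * F))) (^-distribˡ-+-* pmax k k) ⟩
        n * n * (2 * (pmax ^ k * pmax ^ k * F))    ≡⟨ e n (pmax ^ k) F ⟩
        2 * F * (n * pmax ^ k * (n * pmax ^ k))    ≤⟨ *-monoʳ-≤ (2 * F) (*-mono-≤ n*pmax^k≤Q^k n*pmax^k≤Q^k) ⟩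
        2 * F * (Q ^ k * Q ^ k)                    ≡⟨ cong (2 * F *_) (^-distribˡ-+-* Q k k) ⟨
        2 * F * Q ^ (k + k)                        ∎)
        where
        open ≤-Reasoning
        F = ∑ (words Ds M) found
        e : ∀ n a F → n * n * (2 * (a * a * F)) ≡ 2 * F * (n * a * (n * a))
        e = solve-∀

open import Defs
open import Data.Bool using (Bool; true; false; if_then_else_; not; _∧_; _∨_; T)
open import Data.Bool.Properties using (T-≡; ∨-zeroʳ)
open import Data.Fin as Fin using (Fin; zero; suc; toℕ)
open import Data.Fin.Properties using (toℕ-injective)
open import Data.List.Relation.Unary.All.Properties using (++⁺; ++⁻)
open import Data.List.Relation.Unary.Any.Properties using (reverse⁻)
open import Data.List.Relation.Unary.Unique.Propositional.Properties using (allFin⁺; filter⁺; cartesianProduct⁺)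
open import Data.Maybe as Maybe using (Maybe; just; nothing; maybe′)
open import Data.Nat.DivMod using (m/n*n≡m)
open import Data.Nat.Divisibility using (_∣_; ∣-trans; m∣m*n; m≤n⇒m!∣n!)
open import Data.Vec as Vec using (Vec; []; _∷_; toList)
import Data.Vec.Membership.DecPropositional as VDec
import Data.Vec.Membership.Propositional as VMem
open import Data.Vec.Membership.Propositional.Properties using (∈-toList⁺) renaming (∈-lookup to ∈-vlookup)
open import Data.Vec.Properties using (toList-∷ʳ; length-toList)
import Data.Vec.Relation.Unary.Any as VAny
import Data.Vec.Relation.Unary.Any.Properties as VAny
open import Function.Bundles using (Equivalence)

-- Cyclic words

module _ {a} {A : Set a} where

  rotates-suc : ∀ i (s : List A) → rotates (suc i) s ≡ rotate (rotates i s)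
  rotates-suc zero    s = refl
  rotates-suc (suc i) s = rotates-suc i (rotate s)

  rotates-length : ∀ (s : List A) → rotates (length s) s ≡ s
  rotates-length s = trans (cong (rotates (length s)) (sym (++-identityʳ s))) (rotates-++ s [])

  -- Lets a property known for the rotations below the length be used for all of them.
  rotates-mod : ∀ (s : List A) → 0 < length s → ∀ i → ∃ λ j → j < length s × rotates i s ≡ rotates j s
  rotates-mod s s>0 zero    = 0 , s>0 , refl
  rotates-mod s s>0 (suc i) with rotates-mod s s>0 i
  ... | j , j< , eq with suc j ≟ℕ length s
  ... | yes sj≡ = 0 , s>0 , trans (rotates-suc i s) (trans (cong rotate eq)
                    (trans (sym (rotates-suc j s)) (trans (cong (λ m → rotates m s) sj≡) (rotates-length s))))
  ... | no  sj≢ = suc j , ≤∧≢⇒< j< sj≢ , trans (rotates-suc i s) (trans (cong rotate eq) (sym (rotates-suc j s)))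

  length-rotate : ∀ (s : List A) → length (rotate s) ≡ length s
  length-rotate []      = refl
  length-rotate (x ∷ s) = trans (length-++ s) (+-comm (length s) 1)

  length-rotates : ∀ i (s : List A) → length (rotates i s) ≡ length s
  length-rotates zero    s = refl
  length-rotates (suc i) s = trans (length-rotates i (rotate s)) (length-rotate s)

  minimum-split : (key : A → ℕ) → ∀ x xs →
    ∃ λ u → ∃ λ y → ∃ λ v → x ∷ xs ≡ u ++ y ∷ v × All (λ z → key y ≤ key z) (x ∷ xs)
  minimum-split key x []        = [] , x , [] , refl , ≤-refl ∷ []
  minimum-split key x (x′ ∷ xs) with minimum-split key x′ xs
  ... | u , y , v , eq , y≤ with ≤-total (key x) (key y)
  ... | inj₁ x≤y = [] , x , x′ ∷ xs , refl , ≤-refl ∷ All.map (≤-trans x≤y) y≤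
  ... | inj₂ y≤x = x ∷ u , y , v , cong (x ∷_) eq , y≤x ∷ y≤

  reverse-split : ∀ (u : List A) x w y v →
    reverse (u ++ x ∷ w ++ y ∷ v) ≡ reverse v ++ y ∷ reverse w ++ x ∷ reverse u
  reverse-split u x w y v = begin
    reverse (u ++ x ∷ w ++ y ∷ v)
      ≡⟨ reverse-++ u (x ∷ w ++ y ∷ v) ⟩
    reverse (x ∷ w ++ y ∷ v) ++ reverse u
      ≡⟨ cong (_++ reverse u) (trans (unfold-reverse x (w ++ y ∷ v)) (cong (_++ x ∷ [])
           (trans (reverse-++ w (y ∷ v)) (cong (_++ reverse w) (unfold-reverse y v))))) ⟩
    (((reverse v ++ y ∷ []) ++ reverse w) ++ x ∷ []) ++ reverse u
      ≡⟨ ++-assoc ((reverse v ++ y ∷ []) ++ reverse w) (x ∷ []) (reverse u) ⟩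
    ((reverse v ++ y ∷ []) ++ reverse w) ++ x ∷ reverse u
      ≡⟨ ++-assoc (reverse v ++ y ∷ []) (reverse w) _ ⟩
    (reverse v ++ y ∷ []) ++ reverse w ++ x ∷ reverse u
      ≡⟨ ++-assoc (reverse v) (y ∷ []) _ ⟩
    reverse v ++ y ∷ reverse w ++ x ∷ reverse u ∎
    where open ≡-Reasoning

  length-split : ∀ (u : List A) x w y v →
    length (u ++ x ∷ w ++ y ∷ v) ≡ 2 + length w + (length v + length u)
  length-split u x w y v = trans (length-++ u) (trans (cong (λ t → length u + suc t) (length-++ w))
    (e (length u) (length w) (length v)))
    where
    e : ∀ a b c → a + suc (b + suc c) ≡ 2 + b + (c + a)
    e = solve-∀

  lookup-split : ∀ {n} (s : Vec A n) i →
    ∃ λ u → ∃ λ v → toList s ≡ u ++ Vec.lookup s i ∷ v × length u ≡ toℕ i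
  lookup-split (x ∷ s) zero    = [] , toList s , refl , refl
  lookup-split (x ∷ s) (suc i) with lookup-split s i
  ... | u , v , eq , len = x ∷ u , v , cong (x ∷_) eq , cong suc len

  lookup-split₂ : ∀ {n} (s : Vec A n) i j → toℕ i < toℕ j →
    ∃ λ u → ∃ λ w → ∃ λ v → toList s ≡ u ++ Vec.lookup s i ∷ w ++ Vec.lookup s j ∷ v ×
                            length u ≡ toℕ i × suc (length u + length w) ≡ toℕ j
  lookup-split₂ (x ∷ s) zero    (suc j) i<j with lookup-split s j
  ... | w , v , eq , len = [] , w , v , cong (x ∷_) eq , refl , cong suc len
  lookup-split₂ (x ∷ s) (suc i) (suc j) (s≤s i<j) with lookup-split₂ s i j i<j
  ... | u , w , v , eq , len , len′ = x ∷ u , w , v , cong (x ∷_) eq , cong suc len , cong suc len′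

  last-toList : ∀ {n} (s : Vec A (suc n)) w z → toList s ≡ w ∷ʳ z → Vec.last s ≡ z
  last-toList s w z eq with Vec.initLast s
  ... | ys , y , refl = ∷ʳ-injectiveʳ (toList ys) w (trans (sym (toList-∷ʳ y ys)) eq)

  toVec : ∀ n → List A → Maybe (Vec A n)
  toVec zero    []      = just []
  toVec zero    (_ ∷ _) = nothing
  toVec (suc n) []      = nothing
  toVec (suc n) (x ∷ s) = Maybe.map (x ∷_) (toVec n s)

  toVec-toList : ∀ {n} (s : Vec A n) → toVec n (toList s) ≡ just s
  toVec-toList []      = refl
  toVec-toList (x ∷ s) = cong (Maybe.map (x ∷_)) (toVec-toList s)

  fromLength : ∀ n (s : List A) → length s ≡ n → ∃ λ (v : Vec A n) → toList v ≡ s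
  fromLength _ []      refl = [] , refl
  fromLength _ (x ∷ s) refl with fromLength (length s) s refl
  ... | v , eq = x ∷ v , cong (x ∷_) eq

  allB-true : ∀ (q : A → Bool) xs → (∀ x → q x ≡ true) → allB q xs ≡ true
  allB-true q []       h = refl
  allB-true q (x ∷ xs) h rewrite h x = allB-true q xs h

  countB≡∑ : ∀ (q : A → Bool) xs → countB q xs ≡ ∑ xs (λ x → if q x then 1 else 0)
  countB≡∑ q []       = refl
  countB≡∑ q (x ∷ xs) with q x
  ... | true  = cong suc (countB≡∑ q xs)
  ... | false = countB≡∑ q xs

module _ {a b} {A : Set a} {B : Set b} (f : A → B) where

  map-rotate : ∀ s → map f (rotate s) ≡ rotate (map f s)
  map-rotate []      = refl
  map-rotate (x ∷ s) = map-++ f s (x ∷ [])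

  map-rotates : ∀ i s → map f (rotates i s) ≡ rotates i (map f s)
  map-rotates zero    s = refl
  map-rotates (suc i) s = trans (map-rotates i (rotate s)) (cong (rotates i) (map-rotate s))

  map-split : ∀ s u x v → map f s ≡ u ++ x ∷ v →
    ∃ λ u′ → ∃ λ x′ → ∃ λ v′ → s ≡ u′ ++ x′ ∷ v′ × map f u′ ≡ u × f x′ ≡ x × map f v′ ≡ v
  map-split (y ∷ s) []      x v eq with ∷-injective eq
  ... | fy≡x , fs≡v = [] , y , s , refl , refl , fy≡x , fs≡v
  map-split (y ∷ s) (z ∷ u) x v eq with ∷-injective eq
  ... | fy≡z , eq′ with map-split s u x v eq′
  ... | u′ , x′ , v′ , s≡ , u≡ , x≡ , v≡ = y ∷ u′ , x′ , v′ , cong (y ∷_) s≡ , cong₂ _∷_ fy≡z u≡ , x≡ , v≡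

∑-allFin-suc : ∀ n (f : Fin (suc n) → ℕ) → ∑ (allFin (suc n)) f ≡ f zero + ∑ (allFin n) (f ∘ suc)
∑-allFin-suc n f = cong (f zero +_) (trans (cong (λ xs → ∑ xs f) (sym (map-tabulate id suc)))
                                           (∑-map suc (allFin n) f))

countB-toList : ∀ {a ℓ} {A : Set a} {P : A → Set ℓ} (P? : ∀ x → Dec (P x)) {n} (v : Vec A n) →
  countB (λ x → ⌊ P? x ⌋) (toList v) ≡ ∑ (allFin n) (λ i → 𝟙 (P? (Vec.lookup v i)))
countB-toList P? []      = refl
countB-toList P? {suc n} (x ∷ v) rewrite ∑-allFin-suc n (λ i → 𝟙 (P? (Vec.lookup (x ∷ v) i))) with P? x
... | yes _ = cong suc (countB-toList P? v)
... | no  _ = countB-toList P? v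

countB-lookup : ∀ {a ℓ} {A : Set a} {P : A → Set ℓ} (P? : ∀ x → Dec (P x)) xs →
  countB (λ x → ⌊ P? x ⌋) xs ≡ ∑ (allFin (length xs)) (λ i → 𝟙 (P? (List.lookup xs i)))
countB-lookup P? []       = refl
countB-lookup P? (x ∷ xs) rewrite ∑-allFin-suc (length xs) (λ i → 𝟙 (P? (List.lookup (x ∷ xs) i))) with P? x
... | yes _ = cong suc (countB-lookup P? xs)
... | no  _ = countB-lookup P? xs

-- Lists of the wrong length get 0. This moves the count over vectors to a sum over words, where
-- rotation and reversal act.
indicatorOn : ∀ {a} {A : Set a} {n} → (Vec A n → Bool) → List A → ℕ
indicatorOn {n = n} q s = maybe′ (λ v → if q v then 1 else 0) 0 (toVec n s)

∑-words-allVec : ∀ m n (q : Vec (Fin m) n → Bool) →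
  ∑ (words (allFin m) n) (indicatorOn q) ≡ countB q (allVec m n)
∑-words-allVec m n q = trans (go n (λ v → if q v then 1 else 0)) (sym (countB≡∑ q (allVec m n)))
  where
  go : ∀ n (f : Vec (Fin m) n → ℕ) →
    ∑ (words (allFin m) n) (λ s → maybe′ f 0 (toVec n s)) ≡ ∑ (allVec m n) f
  go zero    f = refl
  go (suc n) f = begin
    ∑ (words (allFin m) (suc n)) (λ s → maybe′ f 0 (toVec (suc n) s))
      ≡⟨ ∑-words-suc (allFin m) n _ ⟩
    ∑ (allFin m) (λ x → ∑ (words (allFin m) n) (λ s → maybe′ f 0 (Maybe.map (x ∷_) (toVec n s))))
      ≡⟨ ∑-cong (allFin m) (λ x → trans (∑-cong (words (allFin m) n) (λ s → maybe-map x (toVec n s)))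
                                        (go n (λ v → f (x ∷ v)))) ⟩
    ∑ (allFin m) (λ x → ∑ (allVec m n) (λ v → f (x ∷ v)))
      ≡⟨ sym (trans (∑-concatMap _ (allFin m) f) (∑-cong (allFin m) (λ x → ∑-map (x ∷_) (allVec m n) f))) ⟩
    ∑ (allVec m (suc n)) f ∎
    where
    open ≡-Reasoning
    maybe-map : ∀ x t → maybe′ f 0 (Maybe.map (x ∷_) t) ≡ maybe′ (λ v → f (x ∷ v)) 0 t
    maybe-map x (just _) = refl
    maybe-map x nothing  = refl

-- Linear cyclic orders and their canonical representatives.

module CyclicWords {E : Set} (key : E → ℕ) (key-injective : ∀ {x y} → key x ≡ key y → x ≡ y)
  (Meets : E → E → Set) (meets-refl : ∀ x → Meets x x) (meets-sym : ∀ {x y} → Meets x y → Meets y x)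
  where

  -- For a word of length `M`, the length of the gap `w` decides whether two positions are
  -- cyclically adjacent: they are neighbours when it is 0, and first and last when it is `M - 2`.
  LinearCyclic : ℕ → List E → Set
  LinearCyclic M es = ∀ u x w y v → es ≡ u ++ x ∷ w ++ y ∷ v →
    ((length w ≡ 0 ⊎ 2 + length w ≡ M) → ¬ x ≡ y × Meets x y) ×
    (¬ length w ≡ 0 → ¬ 2 + length w ≡ M → ¬ Meets x y)

  linearCyclic-reverse : ∀ {M es} → LinearCyclic M es → LinearCyclic M (reverse es)
  linearCyclic-reverse {M} {es} lc u x w y v eq with
    lc (reverse v) y (reverse w) x (reverse u)
       (trans (sym (reverse-involutive es)) (trans (cong reverse eq) (reverse-split u x w y v)))
  ... | adj , far rewrite length-reverse w =
    (λ h → let x≢y , m = adj h in (λ x≡y → x≢y (sym x≡y)) , meets-sym m) ,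
    (λ h₁ h₂ m → far h₁ h₂ (meets-sym m))

  linearCyclic-≢ : ∀ {M es} → LinearCyclic M es → ∀ u x w y v → es ≡ u ++ x ∷ w ++ y ∷ v → ¬ x ≡ y
  linearCyclic-≢ {M} lc u x w y v eq refl with length w ≟ℕ 0 | 2 + length w ≟ℕ M | lc u x w y v eq
  ... | yes h | _     | adj , _   = proj₁ (adj (inj₁ h)) refl
  ... | no _  | yes h | adj , _   = proj₁ (adj (inj₂ h)) refl
  ... | no h  | no h′ | _   , far = far h h′ (meets-refl x)

  Canonical : List E → Set
  Canonical es = ∃ λ x → ∃ λ y → ∃ λ w → ∃ λ z →
    es ≡ x ∷ y ∷ w ∷ʳ z × All (λ t → key x ≤ key t) es × key y < key z

  -- Rotation `i` brings the smallest key to the front. If the second entry then exceeds the last,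
  -- one further rotation sends the minimum to the end, and reversal returns it to the front with
  -- its two neighbours exchanged. Equality of the neighbours is excluded because `M ≥ 3` makes them
  -- distinct positions.
  canonical-representative : ∀ {M} es → length es ≡ M → 3 ≤ M →
    (∀ i → LinearCyclic M (rotates i es)) →
    ∃ λ i → i < M × (Canonical (rotates i es) ⊎ Canonical (reverse (rotates (suc i) es)))
  canonical-representative {M} [] refl () lc
  canonical-representative {M} es@(e ∷ es′) es≡M 3≤M lc with minimum-split key e es′
  ... | u , x , v , es≡ , x≤ = length u , u<M , cases (v ++ u) rotated
    where
    i = length u
    u<M : i < M
    u<M = subst (i <_) (trans (sym (trans (cong length es≡) (length-++ u))) es≡M)
                (m<m+n i (s≤s z≤n))
    rotated : rotates i es ≡ x ∷ v ++ u
    rotated = trans (cong (rotates i) es≡) (rotates-++ u (x ∷ v))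
    x≤rotated : All (λ t → key x ≤ key t) (x ∷ v ++ u)
    x≤rotated with ++⁻ u (subst (All _) es≡ x≤)
    ... | x≤u , x≤xv = ++⁺ x≤xv x≤u
    len : ∀ t → rotates i es ≡ x ∷ t → suc (length t) ≡ M
    len t eq = trans (cong length (sym eq)) (trans (length-rotates i es) es≡M)
    cases : ∀ t → rotates i es ≡ x ∷ t →
      Canonical (rotates i es) ⊎ Canonical (reverse (rotates (suc i) es))
    cases [] eq = contradiction (subst (3 ≤_) (sym (len [] eq)) 3≤M) λ { (s≤s ()) }
    cases (y ∷ t) eq with initLast t
    ... | [] = contradiction (subst (3 ≤_) (sym (len _ eq)) 3≤M) λ { (s≤s (s≤s ())) }
    ... | w ∷ʳ′ z with <-cmp (key y) (key z)
    ... | tri< y<z _ _ = inj₁ (x , y , w , z , eq , subst (All _) (sym rotated) x≤rotated , y<z)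
    ... | tri≈ _ y≡z _ = contradiction (key-injective y≡z)
                           (linearCyclic-≢ (lc i) (x ∷ []) y w z [] eq)
    ... | tri> _ _ z<y = inj₂ (x , z , reverse w , y , reversed , subst (All _) (sym reversed) x≤reversed , z<y)
      where
      xt = x ∷ y ∷ w ∷ʳ z
      reversed : reverse (rotates (suc i) es) ≡ x ∷ z ∷ reverse w ∷ʳ y
      reversed = begin
        reverse (rotates (suc i) es)          ≡⟨ cong reverse (rotates-suc i es) ⟩
        reverse (rotate (rotates i es))       ≡⟨ cong (reverse ∘ rotate) eq ⟩
        reverse ((y ∷ w ∷ʳ z) ∷ʳ x)           ≡⟨ reverse-++ (y ∷ w ∷ʳ z) (x ∷ []) ⟩
        x ∷ reverse (y ∷ w ∷ʳ z)              ≡⟨ cong (x ∷_) (reverse-split [] y w z []) ⟩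
        x ∷ z ∷ reverse w ∷ʳ y                ∎
        where open ≡-Reasoning
      x≤xt : All (λ t → key x ≤ key t) xt
      x≤xt = subst (All _) (trans (sym rotated) eq) x≤rotated
      x≤reversed : All (λ t → key x ≤ key t) (x ∷ z ∷ reverse w ∷ʳ y)
      x≤reversed with x≤xt
      ... | x≤x ∷ x≤y ∷ x≤wz with ++⁻ w x≤wz
      ... | x≤w , x≤z ∷ [] = x≤x ∷ x≤z ∷ ++⁺ (All.tabulate (All.lookup x≤w ∘ reverse⁻)) (x≤y ∷ [])

-- Auxiliary facts on lists, indicators, maxima and divisibility.

lookup-injective : ∀ {a} {A : Set a} {xs : List A} → Unique xs → ∀ i j →
  List.lookup xs i ≡ List.lookup xs j → i ≡ j
lookup-injective (x∉ ∷ xs!) zero    zero    eq = refl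
lookup-injective (x∉ ∷ xs!) zero    (suc j) eq = contradiction eq (All.lookup x∉ (∈-lookup j))
lookup-injective (x∉ ∷ xs!) (suc i) zero    eq = contradiction (sym eq) (All.lookup x∉ (∈-lookup i))
lookup-injective (x∉ ∷ xs!) (suc i) (suc j) eq = cong suc (lookup-injective xs! i j eq)

take-∈ : ∀ {a} {A : Set a} k (w : List A) y v → length w < k → y ∈ take k (w ++ y ∷ v)
take-∈ (suc k) []      y v _         = here refl
take-∈ (suc k) (x ∷ w) y v (s≤s w<k) = there (take-∈ k w y v w<k)

𝟙≡0⇒¬ : ∀ {ℓ} {P : Set ℓ} (P? : Dec P) → 𝟙 P? ≡ 0 → ¬ P
𝟙≡0⇒¬ (no ¬p) _ = ¬p

𝟙*𝟙≤ : ∀ {ℓ₁ ℓ₂} {P : Set ℓ₁} {R : Set ℓ₂} {n} (P? : Dec P) (R? : Dec R) →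
  (P → R → 1 ≤ n) → 𝟙 P? * 𝟙 R? ≤ n
𝟙*𝟙≤ (yes p) (yes r) h = h p r
𝟙*𝟙≤ (yes _) (no _)  h = z≤n
𝟙*𝟙≤ (no _)  _       h = z≤n

length-filter-countB : ∀ {a ℓ} {A : Set a} {P : A → Set ℓ} (P? : ∀ x → Dec (P x)) xs →
  length (filter P? xs) ≡ countB (λ x → does (P? x)) xs
length-filter-countB P? []       = refl
length-filter-countB P? (x ∷ xs) with P? x
... | yes _ = cong suc (length-filter-countB P? xs)
... | no  _ = length-filter-countB P? xs

∑-cartesianProduct-Bool : ∀ {a} {A : Set a} (xs : List A) (f : A × Bool → ℕ) →
  ∑ (cartesianProduct xs (false ∷ true ∷ [])) f ≡ ∑ xs (λ x → f (x , false) + f (x , true))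
∑-cartesianProduct-Bool []       f = refl
∑-cartesianProduct-Bool (x ∷ xs) f =
  trans (sym (+-assoc (f (x , false)) (f (x , true)) _)) (cong (f (x , false) + f (x , true) +_) (∑-cartesianProduct-Bool xs f))

∑-words-proj₁ : ∀ {a} {A : Set a} (xs : List A) l (F : List A → ℕ) →
  ∑ (words (cartesianProduct xs (false ∷ true ∷ [])) l) (F ∘ map proj₁) ≡ 2 ^ l * ∑ (words xs l) F
∑-words-proj₁ xs zero    F = sym (*-identityˡ (F [] + 0))
∑-words-proj₁ xs (suc l) F = begin
  ∑ (words ds (suc l)) (F ∘ map proj₁)
    ≡⟨ ∑-words-suc ds l _ ⟩
  ∑ ds (λ d → ∑ (words ds l) (λ v → F (proj₁ d ∷ map proj₁ v)))
    ≡⟨ ∑-cong ds (λ d → ∑-words-proj₁ xs l (λ v → F (proj₁ d ∷ v))) ⟩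
  ∑ ds (λ d → 2 ^ l * ∑ (words xs l) (λ v → F (proj₁ d ∷ v)))
    ≡⟨ ∑-cartesianProduct-Bool xs _ ⟩
  ∑ xs (λ x → 2 ^ l * G x + 2 ^ l * G x)
    ≡⟨ ∑-cong xs (λ x → e (2 ^ l) (G x)) ⟩
  ∑ xs (λ x → 2 ^ suc l * G x)
    ≡⟨ ∑-*ˡ xs (2 ^ suc l) G ⟩
  2 ^ suc l * ∑ xs G
    ≡⟨ cong (2 ^ suc l *_) (∑-words-suc xs l F) ⟨
  2 ^ suc l * ∑ (words xs (suc l)) F ∎
  where
  open ≡-Reasoning
  ds = cartesianProduct xs (false ∷ true ∷ [])
  G = λ x → ∑ (words xs l) (λ v → F (x ∷ v))
  e : ∀ a b → a * b + a * b ≡ 2 * a * b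
  e = solve-∀

maximum : ∀ {a} {A : Set a} → (A → ℕ) → List A → ℕ
maximum f []       = 0
maximum f (x ∷ xs) = f x ⊔ maximum f xs

≤maximum : ∀ {a} {A : Set a} (f : A → ℕ) {xs x} → x ∈ xs → f x ≤ maximum f xs
≤maximum f (here refl)             = m≤m⊔n _ _
≤maximum f {xs = y ∷ _} (there x∈) = ≤-trans (≤maximum f x∈) (m≤n⊔m (f y) _)

maximum-preserves : ∀ {a ℓ} {A : Set a} (P : ℕ → Set ℓ) (f : A → ℕ) xs →
  P 0 → (∀ x → P (f x)) → P (maximum f xs)
maximum-preserves P f []       p0 pf = p0
maximum-preserves P f (x ∷ xs) p0 pf with ⊔-sel (f x) (maximum f xs)
... | inj₁ eq = subst P (sym eq) (pf x)
... | inj₂ eq = subst P (sym eq) (maximum-preserves P f xs p0 pf)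

quot : ℕ → ℕ → ℕ
quot q zero    = 0
quot q (suc d) = q / suc d

quot-* : ∀ q d → 0 < d → d ∣ q → quot q d * d ≡ q
quot-* q (suc d) _ d∣q = m/n*n≡m d∣q

∣! : ∀ d n → 0 < d → d ≤ n → d ∣ n !
∣! (suc d) n _ d≤n = ∣-trans (m∣m*n (d !)) (m≤n⇒m!∣n! d≤n)

∧-true : ∀ {b c} → b ≡ true → c ≡ true → b ∧ c ≡ true
∧-true refl refl = refl

T⇒≡ : ∀ {b} → T b → b ≡ true
T⇒≡ = Equivalence.to T-≡

-- The graph spanned by the first two classes

module LinearGraph {r′ : ℕ} (G : RPartiteGraph (2 + r′)) (rpartite : IsRPartite G) (linear : IsLinear G)
  (link>0 : ∀ v → RPartiteGraph.part G v < 2 → 0 < linkSize G v)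
  where
  open RPartiteGraph G
  open VDec (Fin._≟_ {N}) using (_∈?_)

  r : ℕ
  r = 2 + r′

  E : Set
  E = Fin (length edges)

  edge : E → Vec (Fin N) r
  edge = List.lookup edges

  edge-part : ∀ e i → part (Vec.lookup (edge e) i) ≡ toℕ i
  edge-part e = proj₁ (proj₂ rpartite) (edge e) (∈-lookup e)

  position : ∀ {w e} → w VMem.∈ edge e → ∃ λ i → w ≡ Vec.lookup (edge e) i
  position w∈ = VAny.index w∈ , VAny.lookup-index w∈

  edges-share : ∀ {e f u w} → u VMem.∈ edge e → u VMem.∈ edge f → w VMem.∈ edge e → w VMem.∈ edge f →
    ¬ u ≡ w → e ≡ f
  edges-share {e} {f} {u} {w} ue uf we wf u≢w with e Fin.≟ f
  ... | yes e≡f = e≡f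
  ... | no  e≢f = contradiction
    (linear (edge e) (edge f) (∈-lookup e) (∈-lookup f)
            (λ eq → e≢f (lookup-injective (proj₂ (proj₂ rpartite)) e f eq)) u w ue uf we wf) u≢w

  Dart : Set
  Dart = E × Bool

  side : Bool → Fin r
  side false = zero
  side true  = suc zero

  tail head : Dart → Fin N
  tail (e , b) = Vec.lookup (edge e) (side b)
  head (e , b) = Vec.lookup (edge e) (side (not b))

  inv : Dart → Dart
  inv (e , b) = e , not b

  Ds : List Dart
  Ds = cartesianProduct (allFin (length edges)) (false ∷ true ∷ [])

  Ds! : Unique Ds
  Ds! = cartesianProduct⁺ (allFin⁺ (length edges)) (((λ ()) ∷ []) ∷ ([] ∷ []))

  Vs : List (Fin N)
  Vs = filter (λ v → part v <? 2) (allFin N)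

  side<2 : ∀ b → toℕ (side b) < 2
  side<2 false = s≤s z≤n
  side<2 true  = s≤s (s≤s z≤n)

  end∈Vs : ∀ e b → Vec.lookup (edge e) (side b) ∈ Vs
  end∈Vs e b = ∈-filter⁺ (λ v → part v <? 2) (∈-allFin _) (subst (_< 2) (sym (edge-part e (side b))) (side<2 b))

  head∈edge : ∀ d → head d VMem.∈ edge (proj₁ d)
  head∈edge (e , b) = ∈-vlookup (side (not b)) (edge e)

  tail∈edge : ∀ d → tail d VMem.∈ edge (proj₁ d)
  tail∈edge (e , b) = ∈-vlookup (side b) (edge e)

  tail≢head : ∀ d → ¬ tail d ≡ head d
  tail≢head (e , false) eq with trans (sym (edge-part e zero)) (trans (cong part eq) (edge-part e (suc zero)))
  ... | ()
  tail≢head (e , true)  eq with trans (sym (edge-part e (suc zero))) (trans (cong part eq) (edge-part e zero))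
  ... | ()

  dart-unique : ∀ {d d′} → proj₁ d ≡ proj₁ d′ → head d ≡ head d′ → d ≡ d′
  dart-unique {e , false} {_ , false} refl _  = refl
  dart-unique {e , true}  {_ , true}  refl _  = refl
  dart-unique {e , false} {_ , true}  refl eq = contradiction (sym eq) (tail≢head (e , false))
  dart-unique {e , true}  {_ , false} refl eq = contradiction (sym eq) (tail≢head (e , true))

  degree : Fin N → ℕ
  degree x = ∑ Ds (λ d → 𝟙 (x Fin.≟ tail d))

  -- A vertex of the first two classes can only occupy position 0 or 1 of an edge, and it is the
  -- tail of exactly one of the two darts of each edge through it.
  degree≡linkSize : ∀ x → part x < 2 → degree x ≡ linkSize G x
  degree≡linkSize x x<2 = trans (∑-cartesianProduct-Bool (allFin (length edges)) _)
    (trans (∑-cong (allFin (length edges)) pointwise) (sym (countB-lookup (x ∈?_) edges)))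
    where
    pointwise : ∀ e → 𝟙 (x Fin.≟ tail (e , false)) + 𝟙 (x Fin.≟ tail (e , true)) ≡ 𝟙 (x ∈? edge e)
    pointwise e with x Fin.≟ tail (e , false) | x Fin.≟ tail (e , true) | x ∈? edge e
    ... | yes x≡a | yes x≡b | _      = contradiction (trans (sym x≡a) x≡b) (tail≢head (e , false))
    ... | yes x≡a | no _    | yes _  = refl
    ... | no _    | yes x≡b | yes _  = refl
    ... | no _    | no _    | no _   = refl
    ... | yes x≡a | no _    | no x∉  = contradiction (subst (VMem._∈ edge e) (sym x≡a) (tail∈edge (e , false))) x∉
    ... | no _    | yes x≡b | no x∉  = contradiction (subst (VMem._∈ edge e) (sym x≡b) (tail∈edge (e , true))) x∉
    ... | no x≢a  | no x≢b  | yes x∈ with position {e = e} x∈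
    ... | zero , x≡           = contradiction x≡ x≢a
    ... | suc zero , x≡       = contradiction x≡ x≢b
    ... | i@(suc (suc _)) , x≡ = contradiction (subst (_< 2) (trans (cong part x≡) (edge-part e i)) x<2)
                                               (λ { (s≤s (s≤s ())) })

  -- Every degree of a vertex in `Vs` lies between 1 and `length Ds`, so it divides this factorial.
  Qᴳ : ℕ
  Qᴳ = length Ds !

  -- The value 0 outside the first two classes keeps the other vertices from raising the maximum
  -- `pmax`.
  pᴳ : Fin N → ℕ
  pᴳ x with part x <? 2
  ... | yes _ = quot Qᴳ (degree x)
  ... | no  _ = 0

  degree>0 : ∀ x → part x < 2 → 0 < degree x
  degree>0 x x<2 = subst (0 <_) (sym (degree≡linkSize x x<2)) (link>0 x x<2)

  degree≤ : ∀ x → degree x ≤ length Ds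
  degree≤ x = ≤-trans (∑-mono Ds (λ d → 𝟙≤1 (x Fin.≟ tail d)))
    (≤-reflexive (trans (∑-const Ds 1) (*-identityʳ _)))

  pᴳ*degree : ∀ x → part x < 2 → pᴳ x * degree x ≡ Qᴳ
  pᴳ*degree x x<2 with part x <? 2
  ... | yes _   = quot-* Qᴳ (degree x) (degree>0 x x<2) (∣! (degree x) (length Ds) (degree>0 x x<2) (degree≤ x))
  ... | no  x≮2 = contradiction x<2 x≮2

  network : Network
  network = record
    { V = Fin N ; D = Dart ; _≟_ = Fin._≟_ ; Vs = Vs ; Ds = Ds ; tail = tail ; head = head ; inv = inv
    ; Vs! = filter⁺ (λ v → part v <? 2) (allFin⁺ N)
    ; tail∈ = λ (e , b) → end∈Vs e b
    ; head∈ = λ (e , b) → end∈Vs e (not b)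
    ; tail-inv = λ _ → refl
    ; head-inv = λ { (e , false) → refl ; (e , true) → refl }
    ; ∑-inv = λ f → trans (∑-cartesianProduct-Bool (allFin (length edges)) (f ∘ inv))
        (trans (∑-cong (allFin (length edges)) (λ e → +-comm (f (e , true)) (f (e , false))))
               (sym (∑-cartesianProduct-Bool (allFin (length edges)) f)))
    ; p = pᴳ ; Q = Qᴳ ; Q>0 = 1≤n! (length Ds)
    ; p*deg = λ {x} x∈ → pᴳ*degree x (proj₂ (∈-filter⁻ (λ v → part v <? 2) {xs = allFin N} x∈))
    }

  -- Conflicts between darts.

  Meets : E → E → Set
  Meets e f = ∃ λ w → w VMem.∈ edge e × w VMem.∈ edge f

  meets? : ∀ e f → Dec (Meets e f)
  meets? e f = map′ VMem.find (λ (w , w∈e , w∈f) → VMem.lose w∈e w∈f) (VAny.any? (_∈? edge f) (edge e))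

  meets-sym : ∀ {e f} → Meets e f → Meets f e
  meets-sym (w , we , wf) = w , wf , we

  meets-refl : ∀ e → Meets e e
  meets-refl e = tail (e , false) , tail∈edge (e , false) , tail∈edge (e , false)

  -- The clause head d ∉ f keeps the number of conflicting darts at a given head bounded by linearity.
  Conf : Dart → Dart → Set
  Conf d f = proj₁ d ≡ proj₁ f ⊎ (¬ head d VMem.∈ edge (proj₁ f) × Meets (proj₁ d) (proj₁ f))

  conf? : ∀ d f → Dec (Conf d f)
  conf? d f = (proj₁ d Fin.≟ proj₁ f) ⊎-dec (¬? (head d ∈? edge (proj₁ f)) ×-dec meets? (proj₁ d) (proj₁ f))

  -- The head `x` fixes the orientation, so it is enough to count edges. One is the edge of `f`
  -- itself; any other conflicting edge joins `x` to one of the `r` vertices of `f`, different from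
  -- `x`, and linearity permits one edge for each such pair.
  conf-bound : ∀ x f → ∑ Ds (λ d → 𝟙 (head d Fin.≟ x) * 𝟙 (conf? d f)) ≤ suc r
  conf-bound x f = begin
    ∑ Ds (λ d → 𝟙 (head d Fin.≟ x) * 𝟙 (conf? d f))
      ≤⟨ ∑-mono Ds pointwise ⟩
    ∑ Ds (λ d → 𝟙 (same? d) + ∑ (allFin r) (λ i → 𝟙 (through? i d)))
      ≡⟨ trans (∑-+ Ds _ _) (cong (∑ Ds (𝟙 ∘ same?) +_) (∑-swap Ds (allFin r) _)) ⟩
    ∑ Ds (𝟙 ∘ same?) + ∑ (allFin r) (λ i → ∑ Ds (𝟙 ∘ through? i))
      ≤⟨ +-mono-≤ (∑-at-most-one same? Ds! same-unique)
           (∑-mono (allFin r) (λ i → ∑-at-most-one (through? i) Ds! (through-unique i))) ⟩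
    1 + ∑ (allFin r) (λ _ → 1)
      ≡⟨ cong suc (trans (∑-const (allFin r) 1) (trans (*-identityʳ _) (length-tabulate {n = r} id))) ⟩
    suc r ∎
    where
    open ≤-Reasoning
    w : Fin r → Fin N
    w = Vec.lookup (edge (proj₁ f))
    Same : Dart → Set
    Same d = head d ≡ x × proj₁ d ≡ proj₁ f
    Through : Fin r → Dart → Set
    Through i d = head d ≡ x × ¬ x ≡ w i × w i VMem.∈ edge (proj₁ d)
    same? : ∀ d → Dec (Same d)
    same? d = (head d Fin.≟ x) ×-dec (proj₁ d Fin.≟ proj₁ f)
    through? : ∀ i d → Dec (Through i d)
    through? i d = (head d Fin.≟ x) ×-dec (¬? (x Fin.≟ w i) ×-dec (w i ∈? edge (proj₁ d)))
    same-unique : ∀ {d d′} → Same d → Same d′ → d ≡ d′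
    same-unique (h , e) (h′ , e′) = dart-unique (trans e (sym e′)) (trans h (sym h′))
    through-unique : ∀ i {d d′} → Through i d → Through i d′ → d ≡ d′
    through-unique i {d} {d′} (refl , x≢w , w∈) (h′ , _ , w∈′) = dart-unique
      (edges-share (head∈edge d) (subst (VMem._∈ edge (proj₁ d′)) h′ (head∈edge d′)) w∈ w∈′ x≢w) (sym h′)
    pointwise : ∀ d → 𝟙 (head d Fin.≟ x) * 𝟙 (conf? d f) ≤
                      𝟙 (same? d) + ∑ (allFin r) (λ i → 𝟙 (through? i d))
    pointwise d = 𝟙*𝟙≤ (head d Fin.≟ x) (conf? d f) covered
      where
      covered : head d ≡ x → Conf d f → 1 ≤ 𝟙 (same? d) + ∑ (allFin r) (λ i → 𝟙 (through? i d))
      covered h (inj₁ e≡f) = ≤-trans (≤-reflexive (sym (𝟙-yes (same? d) (h , e≡f)))) (m≤m+n _ _)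
      covered h (inj₂ (h∉ , v , v∈d , v∈f)) with position {e = proj₁ f} v∈f
      ... | i , refl = ≤-trans (≤-reflexive (sym (𝟙-yes (through? i d) (h , x≢v , v∈d))))
        (≤-trans (term≤∑ (λ i → 𝟙 (through? i d)) (∈-allFin i)) (m≤n+m _ (𝟙 (same? d))))
        where
        x≢v : ¬ x ≡ w i
        x≢v eq = h∉ (subst (VMem._∈ edge (proj₁ f)) (sym (trans h eq)) v∈f)

  -- Conflict-free closed walks trace linear cycles.

  module CycleCount (l : ℕ) (l>0 : 0 < l) where

    k M : ℕ
    k = suc l
    M = suc (k + l)

    pmax : ℕ
    pmax = maximum pᴳ (allFin N)

    p≤pmax : ∀ x → pᴳ x ≤ pmax
    p≤pmax x = ≤maximum pᴳ (∈-allFin x)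

    weight : List Dart → ℕ
    weight = Walks.weight network

    bad : List Dart → ℕ
    bad = Walks.Conflicts.bad network Conf conf? (suc r) conf-bound pmax p≤pmax k

    open CyclicWords {E} toℕ toℕ-injective Meets meets-refl meets-sym

    -- Quantifying over all `i`, not only those below the length, makes stability under rotation
    -- immediate.
    Conflict-free : List Dart → Set
    Conflict-free s = ¬ weight s ≡ 0 × (∀ i → bad (rotates i s) ≡ 0)

    conflict-free-rotates : ∀ i {s} → Conflict-free s → Conflict-free (rotates i s)
    conflict-free-rotates zero    cf            = cf
    conflict-free-rotates (suc i) {s} (w≢0 , good) = conflict-free-rotates i
      ((λ w≡0 → w≢0 (trans (sym (Walks.weight-rotate network s)) w≡0)) , good ∘ suc)

    no-conflict : ∀ x w y v → Conflict-free (x ∷ w ++ y ∷ v) → length w < k → ¬ Conf x y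
    no-conflict x w y v (_ , good) w<k c =
      𝟙≡0⇒¬ (any? (conf? x) (take k (w ++ y ∷ v))) (good 0) (lose (take-∈ k w y v w<k) c)

    consecutive : ∀ x y v → Conflict-free (x ∷ y ∷ v) → head x ≡ tail y
    consecutive x y v (w≢0 , _) = Walks.weight≢0⇒linked network x y v w≢0

    consecutive-meet : ∀ x y v → Conflict-free (x ∷ y ∷ v) → ¬ proj₁ x ≡ proj₁ y × Meets (proj₁ x) (proj₁ y)
    consecutive-meet x y v cf =
      (λ eq → no-conflict x [] y v cf (s≤s z≤n) (inj₁ eq)) ,
      head x , head∈edge x , subst (VMem._∈ edge (proj₁ y)) (sym (consecutive x y v cf)) (tail∈edge y)

    -- If x meets y then the head of x lies on y; this vertex is the tail of the next dart z, so z
    -- meets y as well, and the gap shrinks until two consecutive edges share both ends of z.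
    distant-disjoint : ∀ x z w y v → Conflict-free (x ∷ z ∷ w ++ y ∷ v) → suc (length w) < k →
      ¬ Meets (proj₁ x) (proj₁ y)
    distant-disjoint x z w y v cf w<k m with head x ∈? edge (proj₁ y)
    ... | no  h∉ = no-conflict x (z ∷ w) y v cf w<k (inj₂ (h∉ , m))
    ... | yes h∈ = impossible w cf w<k
      where
      tz∈y : tail z VMem.∈ edge (proj₁ y)
      tz∈y = subst (VMem._∈ edge (proj₁ y)) (consecutive x z (w ++ y ∷ v) cf) h∈
      impossible : ∀ w → Conflict-free (x ∷ z ∷ w ++ y ∷ v) → ¬ suc (length w) < k
      impossible []       cf w<k = proj₁ (consecutive-meet z y (v ∷ʳ x) rotated)
        (edges-share (tail∈edge z) tz∈y (head∈edge z)
          (subst (VMem._∈ edge (proj₁ y)) (sym (consecutive z y (v ∷ʳ x) rotated)) (tail∈edge y)) (tail≢head z))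
        where
        rotated : Conflict-free (z ∷ y ∷ v ∷ʳ x)
        rotated = conflict-free-rotates 1 cf
      impossible (z′ ∷ w) cf w<k = distant-disjoint z z′ w y (v ∷ʳ x)
        (subst (λ t → Conflict-free (z ∷ z′ ∷ t)) (++-assoc w (y ∷ v) (x ∷ [])) (conflict-free-rotates 1 cf))
        (<⇒≤ w<k) (tail z , tail∈edge z , tz∈y)

    private
      Spaced : ℕ → Dart → Dart → Set
      Spaced n x y = (n ≡ 0 → ¬ proj₁ x ≡ proj₁ y × Meets (proj₁ x) (proj₁ y)) ×
                     (¬ n ≡ 0 → ¬ Meets (proj₁ x) (proj₁ y))

      spaced : ∀ x w y v → Conflict-free (x ∷ w ++ y ∷ v) → length w < k → Spaced (length w) x y
      spaced x []      y v cf w<k = (λ _ → consecutive-meet x y v cf) , (λ h → contradiction refl h)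
      spaced x (z ∷ w) y v cf w<k = (λ ()) , (λ _ → distant-disjoint x z w y v cf w<k)

    -- The two gaps between `x` and `y` around the cycle have total length `2k - 2`, so one of them
    -- is shorter than `k`. The walk is rotated to start at the dart before that gap, be it `x` or
    -- `y`.
    linearCyclic-darts : ∀ {s} → length s ≡ M → Conflict-free s → ∀ u x w y v → s ≡ u ++ x ∷ w ++ y ∷ v →
      ((length w ≡ 0 ⊎ 2 + length w ≡ M) → ¬ proj₁ x ≡ proj₁ y × Meets (proj₁ x) (proj₁ y)) ×
      (¬ length w ≡ 0 → ¬ 2 + length w ≡ M → ¬ Meets (proj₁ x) (proj₁ y))
    linearCyclic-darts {s} s≡M cf u x w y v refl with length w <? k
    ... | yes w<k = (λ { (inj₁ w≡0) → proj₁ near w≡0 ; (inj₂ w≡M-2) → contradiction w<k (too-long w≡M-2) })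
                  , (λ w≢0 _ → proj₂ near w≢0)
      where
      near : Spaced (length w) x y
      near = spaced x w y (v ++ u) (subst Conflict-free
        (trans (rotates-++ u (x ∷ w ++ y ∷ v)) (cong (x ∷_) (++-assoc w (y ∷ v) u)))
        (conflict-free-rotates (length u) cf)) w<k
      -- Here `k ≥ 2` enters: first and last position are separated by `l + l` darts, which is at
      -- least `k` only if `l > 0`.
      too-long : 2 + length w ≡ M → ¬ length w < k
      too-long eq w<k = <⇒≱ w<k (subst (k ≤_) (sym (suc-injective (suc-injective eq))) (+-monoˡ-≤ l l>0))
    ... | no  w≮k = (λ { (inj₁ w≡0) → contradiction (subst (_< k) (sym w≡0) (s≤s z≤n)) w≮k
                       ; (inj₂ w≡M-2) → let e≢ , m = proj₁ opposite (gap≡0 w≡M-2) in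
                                        (λ eq → e≢ (sym eq)) , meets-sym m })
                  , (λ _ w≢M-2 m → proj₂ opposite (w≢M-2 ∘ gap≡0⁻¹) (meets-sym m))
      where
      gap : ℕ
      gap = length (v ++ u)
      total : 2 + length w + gap ≡ M
      total = trans (cong (2 + length w +_) (length-++ v)) (trans (sym (length-split u x w y v)) s≡M)
      gap≡0 : 2 + length w ≡ M → gap ≡ 0
      gap≡0 eq = +-cancelˡ-≡ (2 + length w) gap 0 (trans total (trans (sym eq) (sym (+-identityʳ _))))
      gap≡0⁻¹ : gap ≡ 0 → 2 + length w ≡ M
      gap≡0⁻¹ g≡0 = trans (sym (+-identityʳ _)) (trans (cong (2 + length w +_) (sym g≡0)) total)
      gap<k : gap < k
      gap<k = s≤s (+-cancelˡ-≤ l gap l (≤-trans (+-monoˡ-≤ gap (<⇒≤ (≮⇒≥ w≮k)))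
        (≤-reflexive (suc-injective (suc-injective total)))))
      opposite : Spaced gap y x
      opposite = spaced y (v ++ u) x w (subst Conflict-free
        (trans (cong (rotates (length (u ++ x ∷ w))) (sym (++-assoc u (x ∷ w) (y ∷ v))))
          (trans (rotates-++ (u ++ x ∷ w) (y ∷ v)) (cong (y ∷_) (sym (++-assoc v u (x ∷ w))))))
        (conflict-free-rotates (length (u ++ x ∷ w)) cf)) gap<k

    linearCyclic : ∀ {s} → length s ≡ M → Conflict-free s → LinearCyclic M (map proj₁ s)
    linearCyclic {s} s≡M cf u x w y v eq with map-split proj₁ s u x (w ++ y ∷ v) eq
    ... | u′ , x′ , t′ , refl , refl , refl , t≡ with map-split proj₁ t′ w y v t≡
    ... | w′ , y′ , v′ , refl , refl , refl , refl rewrite length-map proj₁ w′ =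
      linearCyclic-darts s≡M cf u′ x′ w′ y′ v′ refl

    -- From linear cyclic words to the Boolean test of `tCycle`.

    interSize-∑ : ∀ e f → interSize G (edge e) (edge f) ≡
      ∑ (allFin r) (λ i → 𝟙 (Vec.lookup (edge e) i ∈? edge f))
    interSize-∑ e f = countB-toList (_∈? edge f) (edge e)

    interSize≡0 : ∀ {e f} → ¬ Meets e f → interSize G (edge e) (edge f) ≡ 0
    interSize≡0 {e} {f} ¬m = trans (interSize-∑ e f) (trans (∑-cong (allFin r) absent) (∑-0 (allFin r)))
      where
      absent : ∀ i → 𝟙 (Vec.lookup (edge e) i ∈? edge f) ≡ 0
      absent i with Vec.lookup (edge e) i ∈? edge f
      ... | yes w∈ = contradiction (Vec.lookup (edge e) i , ∈-vlookup i (edge e) , w∈) ¬m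
      ... | no  _  = refl

    interSize≡1 : ∀ {e f} → ¬ e ≡ f → Meets e f → interSize G (edge e) (edge f) ≡ 1
    interSize≡1 {e} {f} e≢f (w , w∈e , w∈f) = trans (interSize-∑ e f) (≤-antisym
      (∑-at-most-one (λ i → Vec.lookup (edge e) i ∈? edge f) (allFin⁺ r) unique) at-least-one)
      where
      unique : ∀ {i j} → Vec.lookup (edge e) i VMem.∈ edge f → Vec.lookup (edge e) j VMem.∈ edge f → i ≡ j
      unique {i} {j} i∈ j∈ with i Fin.≟ j
      ... | yes i≡j = i≡j
      ... | no  i≢j = contradiction
        (edges-share (∈-vlookup i (edge e)) i∈ (∈-vlookup j (edge e)) j∈ λ eq → i≢j (toℕ-injective
          (trans (sym (edge-part e i)) (trans (cong part eq) (edge-part e j))))) e≢f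
      at-least-one : 1 ≤ ∑ (allFin r) (λ i → 𝟙 (Vec.lookup (edge e) i ∈? edge f))
      at-least-one with position {e = e} w∈e
      ... | i , refl = ≤-trans (≤-reflexive (sym (𝟙-yes (Vec.lookup (edge e) i ∈? edge f) w∈f)))
                               (term≤∑ (λ i → 𝟙 (Vec.lookup (edge e) i ∈? edge f)) (∈-allFin i))

    Adjacent : ℕ → ℕ → Set
    Adjacent i j = suc i ≡ j ⊎ suc j ≡ i ⊎ (suc i ≡ M × j ≡ 0) ⊎ (suc j ≡ M × i ≡ 0)

    -- The decision procedure copies the shape of `adjacent`, so its `does` computes to that Boolean
    -- and `refl` connects the two.
    adjacent-reflects : ∀ i j → adjacent G M i j ≡ true × Adjacent (toℕ i) (toℕ j) ⊎
                                adjacent G M i j ≡ false × ¬ Adjacent (toℕ i) (toℕ j)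
    adjacent-reflects i j = go (adjacent? (toℕ i) (toℕ j)) refl
      where
      adjacent? : ∀ a b → Dec (Adjacent a b)
      adjacent? a b = (suc a ≟ℕ b) ⊎-dec ((suc b ≟ℕ a) ⊎-dec
        (((suc a ≟ℕ M) ×-dec (b ≟ℕ 0)) ⊎-dec ((suc b ≟ℕ M) ×-dec (a ≟ℕ 0))))
      go : (a? : Dec (Adjacent (toℕ i) (toℕ j))) → does a? ≡ adjacent G M i j →
        adjacent G M i j ≡ true × Adjacent (toℕ i) (toℕ j) ⊎
        adjacent G M i j ≡ false × ¬ Adjacent (toℕ i) (toℕ j)
      go (yes a) eq = inj₁ (sym eq , a)
      go (no ¬a) eq = inj₂ (sym eq , ¬a)

    module _ (s : Vec E M) (lc : LinearCyclic M (toList s)) where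
      private
        at : Fin M → E
        at = Vec.lookup s

      ordered : ∀ i j → toℕ i < toℕ j →
        (Adjacent (toℕ i) (toℕ j) → ¬ at i ≡ at j × Meets (at i) (at j)) ×
        (¬ Adjacent (toℕ i) (toℕ j) → ¬ Meets (at i) (at j))
      ordered i j i<j with lookup-split₂ s i j i<j
      ... | u , w , v , s≡ , u≡i , uw≡j with lc u (at i) w (at j) v s≡
      ... | near , far = near ∘ gap , λ ¬adj → far (¬adj ∘ gap-0) (¬adj ∘ gap-M)
        where
        i+w≡j : suc (toℕ i + length w) ≡ toℕ j
        i+w≡j = trans (cong (λ t → suc (t + length w)) (sym u≡i)) uw≡j
        gap : Adjacent (toℕ i) (toℕ j) → length w ≡ 0 ⊎ 2 + length w ≡ M
        gap (inj₁ si≡j) = inj₁ (+-cancelˡ-≡ (toℕ i) _ 0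
          (suc-injective (trans i+w≡j (trans (sym si≡j) (cong suc (sym (+-identityʳ (toℕ i))))))))
        gap (inj₂ (inj₁ sj≡i)) = contradiction (<-trans i<j (≤-reflexive sj≡i)) (<-irrefl refl)
        gap (inj₂ (inj₂ (inj₁ (_ , j≡0)))) = contradiction (subst (toℕ i <_) j≡0 i<j) λ ()
        gap (inj₂ (inj₂ (inj₂ (sj≡M , i≡0)))) =
          inj₂ (trans (cong suc (trans (cong (λ t → suc (t + length w)) (sym i≡0)) i+w≡j)) sj≡M)
        gap-0 : length w ≡ 0 → Adjacent (toℕ i) (toℕ j)
        gap-0 w≡0 = inj₁ (trans (cong suc (trans (sym (+-identityʳ (toℕ i))) (cong (toℕ i +_) (sym w≡0)))) i+w≡j)
        gap-M : 2 + length w ≡ M → Adjacent (toℕ i) (toℕ j)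
        gap-M w≡ = inj₂ (inj₂ (inj₂ (trans (cong suc (trans (sym i+w≡j) (cong (λ t → suc (t + length w)) i≡0))) w≡ , i≡0)))
          where
          total : 2 + length w + (length v + length u) ≡ 2 + length w + 0
          total = trans (sym (trans (cong length s≡) (length-split u (at i) w (at j) v)))
            (trans (length-toList s) (trans (sym w≡) (sym (+-identityʳ _))))
          i≡0 : toℕ i ≡ 0
          i≡0 = trans (sym u≡i) (m+n≡0⇒n≡0 (length v) (+-cancelˡ-≡ (2 + length w) _ _ total))

      adjacent-sym : ∀ {a b} → Adjacent a b → Adjacent b a
      adjacent-sym (inj₁ h)               = inj₂ (inj₁ h)
      adjacent-sym (inj₂ (inj₁ h))        = inj₁ h
      adjacent-sym (inj₂ (inj₂ (inj₁ h))) = inj₂ (inj₂ (inj₂ h))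
      adjacent-sym (inj₂ (inj₂ (inj₂ h))) = inj₂ (inj₂ (inj₁ h))

      unordered : ∀ i j → ¬ toℕ i ≡ toℕ j →
        (Adjacent (toℕ i) (toℕ j) → interSize G (edge (at i)) (edge (at j)) ≡ 1) ×
        (¬ Adjacent (toℕ i) (toℕ j) → interSize G (edge (at i)) (edge (at j)) ≡ 0)
      unordered i j i≢j with <-cmp (toℕ i) (toℕ j)
      ... | tri≈ _ i≡j _ = contradiction i≡j i≢j
      ... | tri< i<j _ _ = (λ a → let e≢ , m = proj₁ (ordered i j i<j) a in interSize≡1 e≢ m) ,
                           (λ ¬a → interSize≡0 (proj₂ (ordered i j i<j) ¬a))
      ... | tri> _ _ j<i = (λ a → let e≢ , m = proj₁ (ordered j i j<i) (adjacent-sym a) in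
                                  interSize≡1 (λ eq → e≢ (sym eq)) (meets-sym m)) ,
                           (λ ¬a → interSize≡0 (λ m → proj₂ (ordered j i j<i) (¬a ∘ adjacent-sym) (meets-sym m)))

      irreflexive : ∀ a → ¬ Adjacent a a
      irreflexive a (inj₁ h)                               = 1+n≢n h
      irreflexive a (inj₂ (inj₁ h))                        = 1+n≢n h
      irreflexive a (inj₂ (inj₂ (inj₁ (sa≡M , a≡0)))) = 0≢1+n (suc-injective (trans (cong suc (sym a≡0)) sa≡M))
      irreflexive a (inj₂ (inj₂ (inj₂ (sa≡M , a≡0)))) = 0≢1+n (suc-injective (trans (cong suc (sym a≡0)) sa≡M))

      isLinearCycle-true : isLinearCycle G M (λ i → List.lookup edges (Vec.lookup s i)) ≡ true
      isLinearCycle-true = allB-true _ (allFin M) (λ i → allB-true _ (allFin M) (entry i))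
        where
        entry : ∀ i j → (if adjacent G M i j then interSize G (edge (at i)) (edge (at j)) ≡ᵇ 1
          else ((toℕ i ≡ᵇ toℕ j) ∨ (interSize G (edge (at i)) (edge (at j)) ≡ᵇ 0))) ≡ true
        entry i j with toℕ i ≟ℕ toℕ j | adjacent-reflects i j
        ... | yes i≡j | inj₁ (_ , a) = contradiction (subst (Adjacent (toℕ i)) (sym i≡j) a) (irreflexive (toℕ i))
        ... | yes i≡j | inj₂ (eq , _) rewrite eq | T⇒≡ (≡⇒≡ᵇ (toℕ i) (toℕ j) i≡j) = refl
        ... | no  i≢j | inj₁ (eq , a) rewrite eq | proj₁ (unordered i j i≢j) a = refl
        ... | no  i≢j | inj₂ (eq , ¬a) rewrite eq | proj₂ (unordered i j i≢j) ¬a = ∨-zeroʳ _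

    isCanonical-true : ∀ (s : Vec E M) → Canonical (toList s) → isCanonical G M s ≡ true
    isCanonical-true (x ∷ y ∷ s) (_ , _ , w , z , eq , x≤ , y<z) with ∷-injective eq
    ... | refl , eq′ with ∷-injective eq′
    ... | refl , _ = ∧-true
      (allB-true _ (allFin M) (λ i → T⇒≡ (≤⇒≤ᵇ (All.lookup x≤ (∈-toList⁺ (∈-vlookup i (x ∷ y ∷ s)))))))
      (T⇒≡ (<⇒<ᵇ (subst (λ t → toℕ y < toℕ t) (sym (last-toList (y ∷ s) (y ∷ w) z eq′)) y<z)))

    cycleTest : Vec E M → Bool
    cycleTest s = isLinearCycle G M (λ i → List.lookup edges (Vec.lookup s i)) ∧ isCanonical G M s

    cycleTest-counts : ∀ es → length es ≡ M → LinearCyclic M es → Canonical es → indicatorOn cycleTest es ≡ 1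
    cycleTest-counts es es≡M lc can with fromLength M es es≡M
    ... | s , refl rewrite toVec-toList s
                         | ∧-true (isLinearCycle-true s lc) (isCanonical-true s can) = refl

    -- Sums the test over the dihedral orbit of the underlying edge word, since a given walk need
    -- not start at its smallest edge or run in the canonical direction. The shift `suc i` under the
    -- reversal is the one produced by `canonical-representative`.
    found : List Dart → ℕ
    found s = ∑ (upTo M) (λ i → indicatorOn cycleTest (rotates i (map proj₁ s)) +
                                indicatorOn cycleTest (reverse (rotates (suc i) (map proj₁ s))))

    -- The multiplicity of a cycle: two orientations for each of its `M` edges, `M` rotations and
    -- two directions.
    ∑-found : ∑ (words Ds M) found ≡ 2 ^ M * (M * (2 * countB cycleTest (allVec (length edges) M)))
    ∑-found = begin
      ∑ (words Ds M) found
        ≡⟨ ∑-words-proj₁ es M (λ t → ∑ (upTo M) (λ i → F (rotates i t) + F (reverse (rotates (suc i) t)))) ⟩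
      2 ^ M * ∑ ws (λ t → ∑ (upTo M) (λ i → F (rotates i t) + F (reverse (rotates (suc i) t))))
        ≡⟨ cong (2 ^ M *_) (∑-swap ws (upTo M) _) ⟩
      2 ^ M * ∑ (upTo M) (λ i → ∑ ws (λ t → F (rotates i t) + F (reverse (rotates (suc i) t))))
        ≡⟨ cong (2 ^ M *_) (∑-cong (upTo M) (λ i → trans (∑-+ ws _ _) (cong₂ _+_ (∑-words-rotates es M i F)
             (trans (∑-words-rotates es M (suc i) (F ∘ reverse)) (∑-words-reverse es M F))))) ⟩
      2 ^ M * ∑ (upTo M) (λ _ → ∑ ws F + ∑ ws F)
        ≡⟨ cong (2 ^ M *_) (trans (∑-const (upTo M) (∑ ws F + ∑ ws F)) (cong₂ _*_ (length-upTo M) (e (∑ ws F)))) ⟩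
      2 ^ M * (M * (2 * ∑ ws F))
        ≡⟨ cong (λ t → 2 ^ M * (M * (2 * t))) (∑-words-allVec (length edges) M cycleTest) ⟩
      2 ^ M * (M * (2 * countB cycleTest (allVec (length edges) M))) ∎
      where
      open ≡-Reasoning
      es = allFin (length edges)
      ws = words es M
      F = indicatorOn cycleTest
      e : ∀ a → a + a ≡ 2 * a
      e = solve-∀

    cover : ∀ s → length s ≡ M → ¬ weight s ≡ 0 → (∀ i → i < M → bad (rotates i s) ≡ 0) → 1 ≤ found s
    cover s s≡M w≢0 good = conclude (canonical-representative (map proj₁ s) (trans (length-map proj₁ s) s≡M) 3≤M lc)
      where
      cf : Conflict-free s
      cf = w≢0 , λ i → let j , j< , eq = rotates-mod s (subst (0 <_) (sym s≡M) (s≤s z≤n)) i in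
                       trans (cong (bad) eq) (good j (subst (j <_) s≡M j<))
      3≤M : 3 ≤ M
      3≤M = s≤s (s≤s (≤-trans l>0 (m≤m+n l l)))
      lc : ∀ i → LinearCyclic M (rotates i (map proj₁ s))
      lc i = subst (LinearCyclic M) (map-rotates proj₁ i s)
        (linearCyclic (trans (length-rotates i s) s≡M) (conflict-free-rotates i cf))
      len : ∀ i → length (rotates i (map proj₁ s)) ≡ M
      len i = trans (length-rotates i (map proj₁ s)) (trans (length-map proj₁ s) s≡M)
      conclude : (∃ λ i → i < M × (Canonical (rotates i (map proj₁ s)) ⊎
                                   Canonical (reverse (rotates (suc i) (map proj₁ s))))) → 1 ≤ found s
      conclude (i , i<M , c) = ≤-trans (term c) (term≤∑ (λ i → indicatorOn cycleTest (rotates i (map proj₁ s)) +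
                                indicatorOn cycleTest (reverse (rotates (suc i) (map proj₁ s)))) (∈-upTo⁺ i<M))
        where
        term : Canonical (rotates i (map proj₁ s)) ⊎ Canonical (reverse (rotates (suc i) (map proj₁ s))) →
          1 ≤ indicatorOn cycleTest (rotates i (map proj₁ s)) +
              indicatorOn cycleTest (reverse (rotates (suc i) (map proj₁ s)))
        term (inj₁ c) = ≤-trans (≤-reflexive (sym (cycleTest-counts _ (len i) (lc i) c))) (m≤m+n _ _)
        term (inj₂ c) = ≤-trans (≤-reflexive (sym (cycleTest-counts _ (trans (length-reverse (rotates (suc i) (map proj₁ s))) (len (suc i)))
          (linearCyclic-reverse (lc (suc i))) c))) (m≤n+m _ (indicatorOn cycleTest (rotates i (map proj₁ s))))

    -- The minimum degree condition and the resulting count.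

    module _ (D₀ : ℕ) (D₀-large : 64 * suc r * (k * k * k) ≤ D₀) (n>0 : 0 < sizeA12 G)
      (link-large : ∀ v → part v < 2 → D₀ ^ k * sizeA12 G ≤ linkSize G v ^ k)
      where

      n : ℕ
      n = sizeA12 G

      length-Vs : length Vs ≡ n
      length-Vs = length-filter-countB (λ v → part v <? 2) (allFin N)

      -- The bound `m / Q ≤ n^(-1/k) / D₀` in k-th powers, stated as a predicate so that it passes
      -- from each `pᴳ x` to the maximum `pmax`.
      Small : ℕ → Set
      Small m = D₀ ^ k * length Vs * m ^ k ≤ Qᴳ ^ k

      small-0 : Small 0
      small-0 = ≤-trans (≤-reflexive (*-zeroʳ (D₀ ^ k * length Vs))) z≤n

      small-p : ∀ x → Small (pᴳ x)
      small-p x with part x <? 2 in eq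
      ... | no  _   = small-0
      ... | yes x<2 = subst Small p≡ (begin
        D₀ ^ k * length Vs * pᴳ x ^ k    ≡⟨ cong (λ t → D₀ ^ k * t * pᴳ x ^ k) length-Vs ⟩
        D₀ ^ k * n * pᴳ x ^ k            ≤⟨ *-monoˡ-≤ (pᴳ x ^ k) (link-large x x<2) ⟩
        linkSize G x ^ k * pᴳ x ^ k      ≡⟨ ^-distribʳ-* (linkSize G x) (pᴳ x) k ⟨
        (linkSize G x * pᴳ x) ^ k        ≡⟨ cong (_^ k) (trans (*-comm (linkSize G x) (pᴳ x))
                                              (trans (cong (pᴳ x *_) (sym (degree≡linkSize x x<2))) (pᴳ*degree x x<2))) ⟩
        Qᴳ ^ k                           ∎)
        where
        open ≤-Reasoning
        p≡ : pᴳ x ≡ quot Qᴳ (degree x)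
        p≡ rewrite eq = refl

      some-vertex : ∃ λ x → x ∈ Vs
      some-vertex with Vs | length-Vs
      ... | []    | 0≡n = contradiction n>0 (λ h → <⇒≢ h 0≡n)
      ... | x ∷ _ | _   = x , here refl

      cycles : ℕ
      cycles = countB cycleTest (allVec (length edges) M)

      n²≤cycles : n * n ≤ 2 * (2 ^ M * (M * (2 * cycles)))
      n²≤cycles = subst₂ (λ a b → a * a ≤ 2 * b) length-Vs ∑-found
        (Walks.Conflicts.supersaturation network Conf conf? (suc r) conf-bound pmax p≤pmax
          l (s≤s z≤n) (proj₁ some-vertex) (proj₂ some-vertex) D₀ D₀-large
          (maximum-preserves Small pᴳ (allFin N) small-0 small-p) found cover)

      M≡2k : M ≡ 2 * k
      M≡2k = double l
        where
        double : ∀ l → suc (suc l + l) ≡ 2 * suc l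
        double = solve-∀

      cycles≡tCycle : cycles ≡ tCycle G k
      cycles≡tCycle = cong (λ m → countB (λ s → isLinearCycle G m (λ i → List.lookup edges (Vec.lookup s i)) ∧ isCanonical G m s)
        (allVec (length edges) m)) M≡2k

      n²≤tCycle : n ^ 2 ≤ 2 ^ (2 * k) * (8 * k) * tCycle G k
      n²≤tCycle = begin
        n ^ 2                                                      ≡⟨ cong (n *_) (*-identityʳ n) ⟩
        n * n                                                      ≤⟨ n²≤cycles ⟩
        2 * (2 ^ M * (M * (2 * cycles)))                           ≡⟨ cong₂ (λ m t → 2 * (2 ^ m * (m * (2 * t)))) M≡2k cycles≡tCycle ⟩
        2 * (2 ^ (2 * k) * (2 * k * (2 * tCycle G k)))             ≡⟨ e (2 ^ (2 * k)) k (tCycle G k) ⟩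
        2 ^ (2 * k) * (8 * k) * tCycle G k                         ∎
        where
        open ≤-Reasoning
        e : ∀ a k t → 2 * (a * (2 * k * (2 * t))) ≡ a * (8 * k) * t
        e = solve-∀

-- Numerical estimates for the constant.

linkSize>0 : ∀ {r′} (G : RPartiteGraph (2 + r′)) l D₀ → 0 < D₀ → 0 < sizeA12 G →
  ∀ v → D₀ ^ suc l * sizeA12 G ≤ linkSize G v ^ suc l → 0 < linkSize G v
linkSize>0 G l D₀ D₀>0 n>0 v h with linkSize G v
... | suc _ = s≤s z≤n
... | zero  = contradiction (≤-trans (*-mono-≤ (m^n>0 D₀ {{>-nonZero D₀>0}} (suc l)) n>0) h) λ ()

suc≤16^ : ∀ l → suc l ≤ 16 ^ l
suc≤16^ zero    = ≤-refl
suc≤16^ (suc l) = begin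
  suc (suc l)      ≤⟨ +-monoˡ-≤ (suc l) (s≤s (z≤n {l})) ⟩
  suc l + suc l    ≤⟨ +-monoʳ-≤ (suc l) (m≤n*m (suc l) 15) ⟩
  16 * suc l       ≤⟨ *-monoʳ-≤ 16 (suc≤16^ l) ⟩
  16 * 16 ^ l      ∎
  where open ≤-Reasoning

-- Factor by factor: `r + 1 ≤ 2r` turns the left side into `8 * r * k² * 16k`, and then
-- `8 ≤ 2 ^ (r + 1)`, `k² ≤ k ^ r` and `k ≤ 16 ^ (k - 1)` apply.
constant-large : ∀ r′ l → let r = 2 + r′ ; k = suc l in
  64 * suc r * (k * k * k) ≤ 2 ^ (r + 1) * r * k ^ r * 16 ^ k
constant-large r′ l = begin
  64 * suc r * (k * k * k)            ≤⟨ *-monoˡ-≤ (k * k * k) (*-monoʳ-≤ 64 (+-monoˡ-≤ r (s≤s (z≤n {suc r′})))) ⟩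
  64 * (r + r) * (k * k * k)          ≡⟨ e r k ⟩
  8 * r * (k ^ 2) * (16 * k)          ≤⟨ *-mono-≤ (*-mono-≤ (*-monoˡ-≤ r (^-monoʳ-≤ 2 3≤r+1)) (^-monoʳ-≤ k (s≤s (s≤s (z≤n {r′})))))
                                                  (*-monoʳ-≤ 16 (suc≤16^ l)) ⟩
  2 ^ (r + 1) * r * k ^ r * 16 ^ k    ∎
  where
  open ≤-Reasoning
  r = 2 + r′
  k = suc l
  3≤r+1 : 3 ≤ r + 1
  3≤r+1 = s≤s (s≤s (m≤n+m 1 r′))
  e : ∀ r k → 64 * (r + r) * (k * k * k) ≡ 8 * r * (k * (k * 1)) * (16 * k)
  e = solve-∀

import Data.Integer as ℤ
import Data.Integer.Properties as ℤ
open import Data.Nat.Coprimality using (1-coprimeTo) renaming (sym to coprime-sym)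
open import Data.Rational as ℚ using (ℚ; mkℚ; *≤*)
open import Data.Rational.Properties as ℚ using (toℚᵘ-homo-*; toℚᵘ-cancel-≤; toℚᵘ-injective; normalize-coprime)
import Data.Rational.Unnormalised as ℚᵘ
import Data.Rational.Unnormalised.Properties as ℚᵘ

-- Transfer between ℚ and ℕ.

-- `ℕtoℚ` normalises through a gcd; the explicit reduced fraction is the form on which products and
-- comparisons can be unfolded.
ℕtoℚ≡mkℚ : ∀ n → ℕtoℚ n ≡ mkℚ (ℤ.+ n) 0 (coprime-sym (1-coprimeTo n))
ℕtoℚ≡mkℚ n = normalize-coprime (coprime-sym (1-coprimeTo n))

ℕtoℚ-cancel-≤ : ∀ {m n} → ℕtoℚ m ℚ.≤ ℕtoℚ n → m ≤ n
ℕtoℚ-cancel-≤ {m} {n} h with subst₂ ℚ._≤_ (ℕtoℚ≡mkℚ m) (ℕtoℚ≡mkℚ n) h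
... | *≤* h′ = ℤ.drop‿+≤+ (subst₂ ℤ._≤_ (ℤ.*-identityʳ (ℤ.+ m)) (ℤ.*-identityʳ (ℤ.+ n)) h′)

ℕtoℚ-* : ∀ m n → ℕtoℚ (m * n) ≡ ℕtoℚ m ℚ.* ℕtoℚ n
ℕtoℚ-* m n rewrite ℕtoℚ≡mkℚ m | ℕtoℚ≡mkℚ n | ℕtoℚ≡mkℚ (m * n) = toℚᵘ-injective (ℚᵘ.≃-sym
  (ℚᵘ.≃-trans (toℚᵘ-homo-* (mkℚ (ℤ.+ m) 0 (coprime-sym (1-coprimeTo m))) (mkℚ (ℤ.+ n) 0 (coprime-sym (1-coprimeTo n))))
    (ℚᵘ.*≡* (cong (ℤ._* ℤ.+ 1) (sym (ℤ.pos-* m n))))))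

ℕtoℚ-nonNeg : ∀ n → ℚ.NonNegative (ℕtoℚ n)
ℕtoℚ-nonNeg n = subst ℚ.NonNegative (sym (ℕtoℚ≡mkℚ n)) _

^ℚ-lower : ∀ {D} m → ℕtoℚ m ℚ.≤ D → ∀ k → ℕtoℚ (m ^ k) ℚ.≤ D ^ℚ k
^ℚ-lower m m≤D zero    = ℚ.≤-refl
^ℚ-lower {D} m m≤D (suc k) = begin
  ℕtoℚ (m * m ^ k)           ≡⟨ ℕtoℚ-* m (m ^ k) ⟩
  ℕtoℚ m ℚ.* ℕtoℚ (m ^ k)    ≤⟨ ℚ.*-monoʳ-≤-nonNeg (ℕtoℚ (m ^ k)) {{ℕtoℚ-nonNeg (m ^ k)}} m≤D ⟩
  D ℚ.* ℕtoℚ (m ^ k)         ≤⟨ ℚ.*-monoˡ-≤-nonNeg D {{D≥0}} (^ℚ-lower m m≤D k) ⟩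
  D ℚ.* (D ^ℚ k)             ∎
  where
  open ℚ.≤-Reasoning
  D≥0 : ℚ.NonNegative D
  D≥0 = ℚ.nonNegative (ℚ.≤-trans (ℚ.nonNegative⁻¹ (ℕtoℚ m) {{ℕtoℚ-nonNeg m}}) m≤D)

-- Replaces the rational `D` by a natural lower bound, so that the degree condition reaches the
-- counting argument inside ℕ.
power-lower : ∀ {D} m k n t → ℕtoℚ m ℚ.≤ D → (D ^ℚ k) ℚ.* ℕtoℚ n ℚ.≤ ℕtoℚ t → m ^ k * n ≤ t
power-lower {D} m k n t m≤D h = ℕtoℚ-cancel-≤ (begin
  ℕtoℚ (m ^ k * n)           ≡⟨ ℕtoℚ-* (m ^ k) n ⟩
  ℕtoℚ (m ^ k) ℚ.* ℕtoℚ n    ≤⟨ ℚ.*-monoʳ-≤-nonNeg (ℕtoℚ n) {{ℕtoℚ-nonNeg n}} (^ℚ-lower m m≤D k) ⟩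
  (D ^ℚ k) ℚ.* ℕtoℚ n        ≤⟨ h ⟩
  ℕtoℚ t                     ∎)
  where open ℚ.≤-Reasoning

reciprocal : ∀ c → .{{NonZero c}} → ℚ
reciprocal (suc c) = mkℚ (ℤ.+ 1) c (1-coprimeTo (suc c))

reciprocal>0 : ∀ c .{{_ : NonZero c}} → ℚ.0ℚ ℚ.< reciprocal c
reciprocal>0 (suc c) = ℚ.positive⁻¹ (reciprocal (suc c))

reciprocal-≤ : ∀ c .{{_ : NonZero c}} a t → a ≤ c * t → reciprocal c ℚ.* ℕtoℚ a ℚ.≤ ℕtoℚ t
reciprocal-≤ (suc c) a t a≤ct rewrite ℕtoℚ≡mkℚ a | ℕtoℚ≡mkℚ t = toℚᵘ-cancel-≤
  (ℚᵘ.≤-respˡ-≃ (ℚᵘ.≃-sym (toℚᵘ-homo-* (reciprocal (suc c)) (mkℚ (ℤ.+ a) 0 (coprime-sym (1-coprimeTo a)))))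
    (ℚᵘ.*≤* (begin
      ℤ.+ 1 ℤ.* ℤ.+ a ℤ.* ℤ.+ 1      ≡⟨ trans (ℤ.*-identityʳ _) (ℤ.*-identityˡ (ℤ.+ a)) ⟩
      ℤ.+ a                      ≤⟨ ℤ.+≤+ a≤ct ⟩
      ℤ.+ (suc c * t)            ≡⟨ cong ℤ.+_ (trans (*-comm (suc c) t) (cong (t *_) (sym (*-identityʳ (suc c))))) ⟩
      ℤ.+ (t * (suc c * 1))      ≡⟨ ℤ.pos-* t (suc c * 1) ⟩
      ℤ.+ t ℤ.* ℤ.+ (suc c * 1)    ∎)))
  where open ℤ.≤-Reasoning

theorem5p7 : (k r : ℕ) → 2 ≤ k → 2 ≤ r →
    Σ (ℚ → ℚ) λ α →
    (∀ (lam : ℚ) → ℚ.1ℚ ℚ.≤ lam → ℚ.0ℚ ℚ.< α lam) ×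
    (∀ (D : ℚ) → ℕtoℚ (2 ^ (r + 1) * r * k ^ r * 16 ^ k) ℚ.≤ D →
    Σ ℕ λ n₀ → ∀ (lam : ℚ) → ℚ.1ℚ ℚ.≤ lam →
    ∀ (G : RPartiteGraph r) → IsRPartite G → IsLinear G →
    n₀ ≤ sizeA12 G →
    (∀ (v : Fin (RPartiteGraph.N G)) → RPartiteGraph.part G v Data.Nat.< 2 →
    ((D ^ℚ k) ℚ.* ℕtoℚ (sizeA12 G) ℚ.≤ ℕtoℚ (linkSize G v ^ k))
    × (ℕtoℚ (linkSize G v ^ k)
    ℚ.≤ ((lam ℚ.* D) ^ℚ k) ℚ.* ℕtoℚ (sizeA12 G))) →
    α lam ℚ.* ℕtoℚ (sizeA12 G ^ 2) ℚ.≤ ℕtoℚ (tCycle G k))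
theorem5p7 k@(suc l) r@(suc (suc r′)) (s≤s l>0) (s≤s (s≤s z≤n)) =
  (λ _ → reciprocal c) , (λ _ _ → reciprocal>0 c) ,
  -- The threshold 1 provides a vertex in the first two classes, hence a nonempty network.
  λ D D₀≤D → 1 , λ lam _ G rpartite linear n>0 links →
    let link-large = λ v v<2 → power-lower D₀ k (sizeA12 G) (linkSize G v ^ k) D₀≤D (proj₁ (links v v<2))
    in reciprocal-≤ c (sizeA12 G ^ 2) (tCycle G k)
      (LinearGraph.CycleCount.n²≤tCycle G rpartite linear
        (λ v v<2 → linkSize>0 G l D₀ (≤-trans (s≤s z≤n) (constant-large r′ l)) n>0 v (link-large v v<2))
        l l>0 D₀ (constant-large r′ l) n>0 link-large)
  where
  D₀ = 2 ^ (r + 1) * r * k ^ r * 16 ^ k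
  -- `2 ^ (2 * k)` orientations, `2 * k` rotations and 2 directions per cycle, and a further factor
  -- 2 for the half of the total weight lost to bad walks.
  c = 2 ^ (2 * k) * (8 * k)
  instance
    c≢0 : NonZero c
    c≢0 = m*n≢0 (2 ^ (2 * k)) (8 * k) {{m^n≢0 2 (2 * k)}}
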